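{- Let $b\ge 0$ and $s,k>0$ be integers such that $b+s$ is odd and $$D=D(b,s,k)=(4bs+1)^k+\bigl(b(4bs+1)^k+s\bigr)^2$$ is squarefree. If $41\cdot 61\cdot 175\cdot 1861$ divides $b$, then $h(D)>1$ unless $b=0$ and $s=1$.
   Context: For a squarefree integer $D>1$, $h(D)$ denotes the class number of the real quadratic field $\mathbb{Q}(\sqrt D)$. (Every integer divides $0$, so $b=0$ is allowed.) -}

module Defs where

open import Algebra.Bundles using (RawRing)
import Algebra.Definitions.RawSemiring as RawSemiringDefinitions
open import Data.Fin.Base using (Fin; toℕ)
open import Data.Integer.Base as ℤ using (ℤ)
open import Data.Nat.Base as ℕ using (ℕ)
open import Data.Nat.Divisibility using (_∣_)
open import Data.Product.Base using (∃; ∃-syntax; Σ-syntax; _×_; _,_)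
open import Data.Rational.Base as ℚ using (ℚ; 0ℚ; 1ℚ)
open import Data.Vec.Functional using (Vector)
open import Function.Definitions using (Bijective)
open import Level using (0ℓ)
open import Relation.Binary.Core using (Rel)
open import Relation.Binary.PropositionalEquality.Core using (_≡_)
open import Relation.Nullary.Negation.Core using (¬_)
open import Relation.Unary using (Pred; _≐_; _∈_)

Odd : ℕ → Set
Odd n = ¬ (2 ∣ n)

Squarefree : ℕ → Set
Squarefree n = ∀ m → m ℕ.* m ∣ n → m ≡ 1

D : (b s k : ℕ) → ℕ
D b s k = a ℕ.+ (b ℕ.* a ℕ.+ s) ℕ.^ 2
  where a = (4 ℕ.* b ℕ.* s ℕ.+ 1) ℕ.^ k

-- Everything below is meant for d > 1 squarefree, so that ℚ[√ d ] is the
-- real quadratic field ℚ(√d) and equality of coordinates is equality.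

record ℚ[√_] (d : ℕ) : Set where
  constructor _+_√
  field
    rational   : ℚ
    irrational : ℚ

module _ (d : ℕ) where

  private
    dℚ : ℚ
    dℚ = ℤ.+ d ℚ./ 1

  ℚ√-rawRing : RawRing 0ℓ 0ℓ
  ℚ√-rawRing = record
    { Carrier = ℚ[√ d ]
    ; _≈_     = _≡_
    ; _+_     = λ { (x + y √) (u + v √) → (x ℚ.+ u) + (y ℚ.+ v) √ }
    ; _*_     = λ { (x + y √) (u + v √) →
                    (x ℚ.* u ℚ.+ dℚ ℚ.* (y ℚ.* v)) + (x ℚ.* v ℚ.+ y ℚ.* u) √ }
    ; -_      = λ { (x + y √) → (ℚ.- x) + (ℚ.- y) √ }
    ; 0#      = 0ℚ + 0ℚ √
    ; 1#      = 1ℚ + 0ℚ √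
    }

  open RawRing ℚ√-rawRing using (rawSemiring; _≈_; _≉_; _*_; 0#)
    renaming (_+_ to _⊕_)
  open RawSemiringDefinitions rawSemiring using (sum; _^_)

  fromℤ : ℤ → ℚ[√ d ]
  fromℤ c = (c ℚ./ 1) + 0ℚ √

  -- The ring of integers: roots of monic integer polynomials
  -- Xⁿ + c₍ₙ₋₁₎ Xⁿ⁻¹ + … + c₁ X + c₀.
  𝓞 : Pred ℚ[√ d ] 0ℓ
  𝓞 α = ∃[ n ] Σ[ c ∈ Vector ℤ n ]
    (α ^ n) ⊕ sum (λ i → fromℤ (c i) * (α ^ toℕ i)) ≈ 0#

  -- Fractional ideals are the nonzero finitely generated 𝓞-submodules of the
  -- field. They are given by generators, so equality of ideals is equality of
  -- the submodules ⟦_⟧, not of the records.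
  record FractionalIdeal : Set where
    field
      size       : ℕ
      generators : Vector ℚ[√ d ] size
      nonzero    : ∃[ i ] generators i ≉ 0#

  ⟦_⟧ : FractionalIdeal → Pred ℚ[√ d ] 0ℓ
  ⟦ I ⟧ x = Σ[ c ∈ Vector ℚ[√ d ] size ]
    (∀ i → c i ∈ 𝓞) × x ≈ sum (λ i → c i * generators i)
    where open FractionalIdeal I

  _·_ : ℚ[√ d ] → Pred ℚ[√ d ] 0ℓ → Pred ℚ[√ d ] 0ℓ
  (α · S) x = ∃[ y ] y ∈ S × x ≈ α * y

  -- Same ideal class: I and J differ by a nonzero principal ideal.
  _∼_ : Rel FractionalIdeal 0ℓ
  I ∼ J = ∃[ α ] α ≉ 0# × ⟦ I ⟧ ≐ (α · ⟦ J ⟧)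

  -- The ideal class group (fractional ideals up to _∼_) has exactly h
  -- elements. This is a relation rather than a function of d because
  -- defining h(d) as a number would require proving the class group finite.
  IsClassNumber : ℕ → Set
  IsClassNumber h = ∃ λ (f : Fin h → FractionalIdeal) → Bijective _≡_ _∼_ f

{-# OPTIONS --safe #-}

-- Put c = 4bs + 1, a = cᵏ and n = ba + s, so that D = a + n².  The element
-- 2bn + 1 + 2b√D has norm c and n - √D has norm -a, and the k-th power of the
-- former is divisible by the latter: ℤ[√D] has a unit η of norm -1.  Parity
-- gives D ≡ 2 (mod 4), so ℤ[√D] is the ring of integers and 2 ramifies as
-- (2, √D)².  If h(D) = 1, that prime has a generator γ, and N(γ) = ±2.
-- But η and γ cannot coexist when D > 2: γ²/2 is a unit of norm 1, and among
-- γ/η and η/(γ²/2) one has a smaller √D-coordinate than the element it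
-- replaces, so that the pair (η, γ) descends forever.

module Submission where

open import Algebra.Bundles using (CommutativeRing; RawRing)
import Algebra.Definitions.RawSemiring as RawSemiringDefinitions
import Algebra.Properties.CommutativeSemigroup as CommutativeSemigroupProperties
import Algebra.Properties.Ring as RingProperties
open import Algebra.Structures using (IsCommutativeRing)
open import Data.Empty using (⊥)
open import Data.Fin.Base using (Fin; zero; suc; toℕ)
open import Data.Fin.Patterns using (0F; 1F)
import Data.Fin.Properties as Fin
open import Data.Integer.Base as ℤ using (ℤ; +_; -[1+_]; ∣_∣; 0ℤ; 1ℤ; -1ℤ)
import Data.Integer.Divisibility.Signed as ℤ
import Data.Integer.Properties as ℤ
import Data.Integer.Tactic.RingSolver as ℤ-RingSolver
open import Data.Nat.Base as ℕ using (ℕ; zero; suc; s≤s; z≤n)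
open import Data.Nat.Coprimality as Coprimality using (Coprime; coprime-divisor)
open import Data.Nat.Divisibility using (_∣_; divides; m%n≡0⇒n∣m; ∣-trans; ∣1⇒≡1; ∣⇒≤)
open import Data.Nat.DivMod using (m%n<n; m≡m%n+[m/n]*n)
open import Data.Nat.Induction using (<-wellFounded)
open import Data.Nat.Primality using (euclidsLemma; prime[2])
import Data.Nat.Properties as ℕ
import Data.Nat.Tactic.RingSolver as ℕ-RingSolver
open import Data.Product.Base using (∃; ∃₂; _×_; _,_; proj₁; proj₂)
open import Data.Rational.Base as ℚ using (ℚ; mkℚ; 0ℚ; 1ℚ; ½; ↥_; ↧_; ↧ₙ_)
import Data.Rational.Properties as ℚ
open import Data.Rational.Unnormalised.Base as ℚᵘ using (mkℚᵘ)
import Data.Rational.Unnormalised.Properties as ℚᵘ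
open import Data.Sum.Base as Sum using (_⊎_; inj₁; inj₂)
open import Data.Vec.Functional using (Vector; []; _∷_)
open import Defs
open import Induction.WellFounded using (Acc; acc)
open import Level using (0ℓ)
open import Relation.Binary.PropositionalEquality
open import Relation.Nullary.Decidable.Core using (yes; no; dec⇒maybe)
open import Relation.Nullary.Negation.Core using (¬_; contradiction)
open import Relation.Unary using (Pred; _∈_)
open import Tactic.RingSolver using (solve-∀)
open import Tactic.RingSolver.Core.AlmostCommutativeRing using (AlmostCommutativeRing; fromCommutativeRing)

-- Norms in ℤ[√D]

-- Why η and γ exclude each other, classically: if some unit has norm -1, so has the fundamental
-- unit ε, and the units of norm 1 are ± the even powers of ε. Then γ²/2 = ±ε²ʲ, so (γ/εʲ)² = ±2,
-- and the field would contain a square root of 2 or of -2. The descent reaches the contradiction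
-- without the structure of the unit group. The exception b = 0, s = 1 is D = 2, where 1 + √2 and
-- √2, of norms -1 and -2, do coexist. The other obstacle is that integers of the field are given as
-- roots of monic polynomials of any degree. In place of minimal polynomials and Gauss's lemma,
-- denominators are bounded: all powers of an integral α share a denominator, hence so do all powers
-- of its norm, and a rational number with this property is an integer. The same holds for α + 1,
-- and the two norms determine the trace.

square-∣∣ : ∀ x → + ∣ x ∣ ℤ.* + ∣ x ∣ ≡ x ℤ.* x
square-∣∣ (+ n) = refl
square-∣∣ -[1+ n ] = refl

-- Opaque, so that unification can read D, x and y off norm D x y.
opaque
  norm : ℤ → ℤ → ℤ → ℤ
  norm D x y = x ℤ.* x ℤ.- D ℤ.* (y ℤ.* y)

  norm-* : ∀ D x y u v →
    norm D (x ℤ.* u ℤ.+ D ℤ.* (y ℤ.* v)) (x ℤ.* v ℤ.+ y ℤ.* u) ≡ norm D x y ℤ.* norm D u v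
  norm-* = expand
    where
    expand : ∀ D x y u v →
      (x ℤ.* u ℤ.+ D ℤ.* (y ℤ.* v)) ℤ.* (x ℤ.* u ℤ.+ D ℤ.* (y ℤ.* v))
        ℤ.- D ℤ.* ((x ℤ.* v ℤ.+ y ℤ.* u) ℤ.* (x ℤ.* v ℤ.+ y ℤ.* u))
      ≡ (x ℤ.* x ℤ.- D ℤ.* (y ℤ.* y)) ℤ.* (u ℤ.* u ℤ.- D ℤ.* (v ℤ.* v))
    expand = ℤ-RingSolver.solve-∀

  norm-def : ∀ D x y → norm D x y ≡ x ℤ.* x ℤ.- D ℤ.* (y ℤ.* y)
  norm-def _ _ _ = refl

  norm-∣∣ : ∀ D x y → norm D (+ ∣ x ∣) (+ ∣ y ∣) ≡ norm D x y
  norm-∣∣ D x y = cong₂ (λ s t → s ℤ.- D ℤ.* t) (square-∣∣ x) (square-∣∣ y)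

  norm-neg : ∀ D x y → norm D x (ℤ.- y) ≡ norm D x y
  norm-neg D x y = cong (λ t → x ℤ.* x ℤ.- D ℤ.* t) (expand y)
    where
    expand : ∀ y → ℤ.- y ℤ.* ℤ.- y ≡ y ℤ.* y
    expand = ℤ-RingSolver.solve-∀

abs-dy² : ∀ d y → ∣ + d ℤ.* (+ y ℤ.* + y) ∣ ≡ d ℕ.* (y ℕ.* y)
abs-dy² d y = trans (ℤ.abs-* (+ d) (+ y ℤ.* + y)) (cong (d ℕ.*_) (ℤ.abs-* (+ y) (+ y)))

module _ {d : ℕ} where

  norm-upper : ∀ {x y M} → norm (+ d) (+ x) (+ y) ≡ M →
    x ℕ.* x ℕ.≤ d ℕ.* (y ℕ.* y) ℕ.+ ∣ M ∣
  norm-upper {x} {y} {M} eq = begin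
    x ℕ.* x
      ≡⟨ ℤ.abs-* (+ x) (+ x) ⟨
    ∣ + x ℤ.* + x ∣
      ≡⟨ cong ∣_∣ (trans (move (+ x ℤ.* + x) dy²) (cong (ℤ._+_ dy²) (sym (norm-def (+ d) (+ x) (+ y))))) ⟩
    ∣ dy² ℤ.+ norm (+ d) (+ x) (+ y) ∣
      ≤⟨ ℤ.∣i+j∣≤∣i∣+∣j∣ dy² _ ⟩
    ∣ dy² ∣ ℕ.+ ∣ norm (+ d) (+ x) (+ y) ∣
      ≡⟨ cong₂ ℕ._+_ (abs-dy² d y) (cong ∣_∣ eq) ⟩
    d ℕ.* (y ℕ.* y) ℕ.+ ∣ M ∣ ∎
    where
    open ℕ.≤-Reasoning
    dy² = + d ℤ.* (+ y ℤ.* + y)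
    move : ∀ i j → i ≡ j ℤ.+ (i ℤ.- j)
    move = ℤ-RingSolver.solve-∀

  norm-lower : ∀ {x y M} → norm (+ d) (+ x) (+ y) ≡ M →
    d ℕ.* (y ℕ.* y) ℕ.≤ x ℕ.* x ℕ.+ ∣ M ∣
  norm-lower {x} {y} {M} eq = begin
    d ℕ.* (y ℕ.* y)
      ≡⟨ abs-dy² d y ⟨
    ∣ dy² ∣
      ≡⟨ cong ∣_∣ (trans (move (+ x ℤ.* + x) dy²) (cong (ℤ._-_ (+ x ℤ.* + x)) (sym (norm-def (+ d) (+ x) (+ y))))) ⟩
    ∣ + x ℤ.* + x ℤ.- norm (+ d) (+ x) (+ y) ∣
      ≤⟨ ℤ.∣i-j∣≤∣i∣+∣j∣ (+ x ℤ.* + x) _ ⟩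
    ∣ + x ℤ.* + x ∣ ℕ.+ ∣ norm (+ d) (+ x) (+ y) ∣
      ≡⟨ cong₂ ℕ._+_ (ℤ.abs-* (+ x) (+ x)) (cong ∣_∣ eq) ⟩
    x ℕ.* x ℕ.+ ∣ M ∣ ∎
    where
    open ℕ.≤-Reasoning
    dy² = + d ℤ.* (+ y ℤ.* + y)
    move : ∀ i j → j ≡ i ℤ.- (i ℤ.- j)
    move = ℤ-RingSolver.solve-∀

  -- The quotient of the two elements has y-coordinate y p - x q, and
  -- (y p - x q) (y p + x q) = M y² - N q² is small.
  reduce : ∀ {p q x y M N} B →
    norm (+ d) (+ p) (+ q) ≡ M → norm (+ d) (+ x) (+ y) ≡ N →
    ∣ M ∣ ℕ.* (y ℕ.* y) ℕ.+ ∣ N ∣ ℕ.* (q ℕ.* q) ℕ.< B ℕ.* (y ℕ.* p ℕ.+ x ℕ.* q) →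
    ∃₂ λ x′ y′ → norm (+ d) (+ x′) (+ y′) ≡ N ℤ.* M × y′ ℕ.< B
  reduce {p} {q} {x} {y} {M} {N} B eqM eqN bound =
    ∣ x′ ∣ , ∣ y′ ∣ , norm≡ , ℕ.*-cancelʳ-< (y ℕ.* p ℕ.+ x ℕ.* q) ∣ y′ ∣ B (ℕ.≤-<-trans small bound)
    where
    -- Multiplication by the conjugate p - q√d agrees with division by p + q√d up to sign, since M =
    -- ±1 wherever the lemma is applied.
    x′ = + x ℤ.* + p ℤ.+ + d ℤ.* (+ y ℤ.* ℤ.- + q)
    y′ = + x ℤ.* ℤ.- + q ℤ.+ + y ℤ.* + p

    norm≡ : norm (+ d) (+ ∣ x′ ∣) (+ ∣ y′ ∣) ≡ N ℤ.* M
    norm≡ = trans (norm-∣∣ (+ d) x′ y′) (trans (norm-* (+ d) (+ x) (+ y) (+ p) (ℤ.- + q))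
      (cong₂ ℤ._*_ eqN (trans (norm-neg (+ d) (+ p) (+ q)) eqM)))

    expand : ∀ D p q x y → (x ℤ.* ℤ.- q ℤ.+ y ℤ.* p) ℤ.* (y ℤ.* p ℤ.+ x ℤ.* q)
      ≡ (p ℤ.* p ℤ.- D ℤ.* (q ℤ.* q)) ℤ.* (y ℤ.* y) ℤ.- (x ℤ.* x ℤ.- D ℤ.* (y ℤ.* y)) ℤ.* (q ℤ.* q)
    expand = ℤ-RingSolver.solve-∀

    small : ∣ y′ ∣ ℕ.* (y ℕ.* p ℕ.+ x ℕ.* q) ℕ.≤ ∣ M ∣ ℕ.* (y ℕ.* y) ℕ.+ ∣ N ∣ ℕ.* (q ℕ.* q)
    small = begin
      ∣ y′ ∣ ℕ.* (y ℕ.* p ℕ.+ x ℕ.* q)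
        ≡⟨ cong (∣ y′ ∣ ℕ.*_) (cong ∣_∣ (cong₂ ℤ._+_ (ℤ.pos-* y p) (ℤ.pos-* x q))) ⟩
      ∣ y′ ∣ ℕ.* ∣ + y ℤ.* + p ℤ.+ + x ℤ.* + q ∣
        ≡⟨ ℤ.abs-* y′ _ ⟨
      ∣ y′ ℤ.* (+ y ℤ.* + p ℤ.+ + x ℤ.* + q) ∣
        ≡⟨ cong ∣_∣ (expand (+ d) (+ p) (+ q) (+ x) (+ y)) ⟩
      ∣ (+ p ℤ.* + p ℤ.- + d ℤ.* (+ q ℤ.* + q)) ℤ.* (+ y ℤ.* + y)
        ℤ.- (+ x ℤ.* + x ℤ.- + d ℤ.* (+ y ℤ.* + y)) ℤ.* (+ q ℤ.* + q) ∣
        ≡⟨ cong₂ (λ m n → ∣ m ℤ.* (+ y ℤ.* + y) ℤ.- n ℤ.* (+ q ℤ.* + q) ∣)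
             (trans (sym (norm-def (+ d) (+ p) (+ q))) eqM) (trans (sym (norm-def (+ d) (+ x) (+ y))) eqN) ⟩
      ∣ M ℤ.* (+ y ℤ.* + y) ℤ.- N ℤ.* (+ q ℤ.* + q) ∣
        ≤⟨ ℤ.∣i-j∣≤∣i∣+∣j∣ (M ℤ.* (+ y ℤ.* + y)) (N ℤ.* (+ q ℤ.* + q)) ⟩
      ∣ M ℤ.* (+ y ℤ.* + y) ∣ ℕ.+ ∣ N ℤ.* (+ q ℤ.* + q) ∣
        ≡⟨ cong₂ ℕ._+_ (trans (ℤ.abs-* M _) (cong (∣ M ∣ ℕ.*_) (ℤ.abs-* (+ y) (+ y))))
                       (trans (ℤ.abs-* N _) (cong (∣ N ∣ ℕ.*_) (ℤ.abs-* (+ q) (+ q)))) ⟩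
      ∣ M ∣ ℕ.* (y ℕ.* y) ℕ.+ ∣ N ∣ ℕ.* (q ℕ.* q) ∎
      where open ℕ.≤-Reasoning

-- No element of norm ±2 next to a unit of norm -1

square-cancel-< : ∀ {m n} → m ℕ.* m ℕ.< n ℕ.* n → m ℕ.< n
square-cancel-< {m} {n} m²<n² = ℕ.≰⇒> λ n≤m → ℕ.<⇒≱ m²<n² (ℕ.*-mono-≤ n≤m n≤m)

Unit± : ℤ → Set
Unit± e = e ≡ 1ℤ ⊎ e ≡ -1ℤ

∣2e∣ : ∀ {e} → Unit± e → ∣ + 2 ℤ.* e ∣ ≡ 2
∣2e∣ (inj₁ refl) = refl
∣2e∣ (inj₂ refl) = refl

module Descent (d : ℕ) (10≤d : 10 ℕ.≤ d) where

  private
    x²≡ : ∀ {x M} → norm (+ d) (+ x) (+ 0) ≡ M → + (x ℕ.* x) ≡ M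
    x²≡ {x} eq = trans (trans (ℤ.pos-* x x) (move (+ x ℤ.* + x) (+ d))) (trans (sym (norm-def (+ d) (+ x) (+ 0))) eq)
      where
      move : ∀ i D → i ≡ i ℤ.- D ℤ.* + 0
      move = ℤ-RingSolver.solve-∀

    10≤d*n² : ∀ {n} → 0 ℕ.< n → 10 ℕ.≤ d ℕ.* (n ℕ.* n)
    10≤d*n² 0<n = ℕ.*-mono-≤ 10≤d (ℕ.*-mono-≤ 0<n 0<n)

  0<q : ∀ {p q} → norm (+ d) (+ p) (+ q) ≡ -1ℤ → 0 ℕ.< q
  0<q {q = suc _} _ = ℕ.z<s
  0<q {p} {zero} eq with () ← x²≡ {p} eq

  0<y : ∀ {x y e} → Unit± e → norm (+ d) (+ x) (+ y) ≡ + 2 ℤ.* e → 0 ℕ.< y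
  0<y {y = suc _} _ _ = ℕ.z<s
  0<y {x} {zero} ±e eq = contradiction (trans (cong ∣_∣ (x²≡ {x} eq)) (∣2e∣ ±e)) (nonsquare x)
    where
    nonsquare : ∀ x → x ℕ.* x ≢ 2
    nonsquare (suc (suc x)) eq = ℕ.<⇒≢ (ℕ.≤-trans (ℕ.m≤m+n 3 1) (ℕ.*-mono-≤ {2} {suc (suc x)} 2≤ 2≤)) (sym eq)
      where 2≤ = s≤s (s≤s z≤n)

  -- Here γ is divided by η. From p² ≥ dq² - 1 ≥ 9 comes p ≥ 3, so y² + 2q² ≤ 3y² ≤ y²p, and the
  -- positive term yxq makes the bound strict.
  reduceγ : ∀ {p q x y e} → Unit± e →
    norm (+ d) (+ p) (+ q) ≡ -1ℤ → norm (+ d) (+ x) (+ y) ≡ + 2 ℤ.* e → q ℕ.≤ y →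
    ∃₂ λ x′ y′ → norm (+ d) (+ x′) (+ y′) ≡ + 2 ℤ.* e ℤ.* -1ℤ × y′ ℕ.< y
  reduceγ {p} {q} {x} {y} {e} ±e eqη eqγ q≤y = reduce y eqη eqγ bound
    where
    open ℕ.≤-Reasoning
    3≤p : 3 ℕ.≤ p
    3≤p = square-cancel-< (ℕ.+-cancelʳ-≤ 1 5 (p ℕ.* p) (begin
      6                   ≤⟨ ℕ.m≤m+n 6 4 ⟩
      10                  ≤⟨ 10≤d*n² (0<q {p} eqη) ⟩
      d ℕ.* (q ℕ.* q)     ≤⟨ norm-lower eqη ⟩
      p ℕ.* p ℕ.+ 1       ∎))
    0<x : 0 ℕ.< x
    0<x = square-cancel-< (ℕ.+-cancelʳ-≤ 2 1 (x ℕ.* x) (begin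
      3                             ≤⟨ ℕ.m≤m+n 3 7 ⟩
      10                            ≤⟨ 10≤d*n² (0<y {x} ±e eqγ) ⟩
      d ℕ.* (y ℕ.* y)               ≤⟨ norm-lower eqγ ⟩
      x ℕ.* x ℕ.+ ∣ + 2 ℤ.* e ∣     ≡⟨ cong (x ℕ.* x ℕ.+_) (∣2e∣ ±e) ⟩
      x ℕ.* x ℕ.+ 2                 ∎))
    collect : ∀ y → 1 ℕ.* (y ℕ.* y) ℕ.+ 2 ℕ.* (y ℕ.* y) ≡ y ℕ.* (y ℕ.* 3)
    collect = ℕ-RingSolver.solve-∀
    instance
      y≢0 : ℕ.NonZero y
      y≢0 = ℕ.>-nonZero (0<y {x} ±e eqγ)
    bound : 1 ℕ.* (y ℕ.* y) ℕ.+ ∣ + 2 ℤ.* e ∣ ℕ.* (q ℕ.* q) ℕ.< y ℕ.* (y ℕ.* p ℕ.+ x ℕ.* q)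
    bound = begin-strict
      1 ℕ.* (y ℕ.* y) ℕ.+ ∣ + 2 ℤ.* e ∣ ℕ.* (q ℕ.* q)
        ≡⟨ cong (λ t → 1 ℕ.* (y ℕ.* y) ℕ.+ t ℕ.* (q ℕ.* q)) (∣2e∣ ±e) ⟩
      1 ℕ.* (y ℕ.* y) ℕ.+ 2 ℕ.* (q ℕ.* q)
        ≤⟨ ℕ.+-monoʳ-≤ (1 ℕ.* (y ℕ.* y)) (ℕ.*-monoʳ-≤ 2 (ℕ.*-mono-≤ q≤y q≤y)) ⟩
      1 ℕ.* (y ℕ.* y) ℕ.+ 2 ℕ.* (y ℕ.* y)
        ≡⟨ collect y ⟩
      y ℕ.* (y ℕ.* 3)
        ≤⟨ ℕ.*-monoʳ-≤ y (ℕ.*-monoʳ-≤ y 3≤p) ⟩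
      y ℕ.* (y ℕ.* p)
        <⟨ ℕ.*-monoʳ-< y (ℕ.m<m+n (y ℕ.* p) (ℕ.*-mono-≤ 0<x (0<q {p} eqη))) ⟩
      y ℕ.* (y ℕ.* p ℕ.+ x ℕ.* q) ∎

  -- Here η is divided by γ²/2, which has integer coordinates because x² = dy² + 2e gives (x² +
  -- dy²)/2 = dy² + e. The bound splits into q² < q²∣t∣ and w² ≤ pq∣w∣. The latter needs x < p:
  -- since y + 1 ≤ q, the gap between dy² and dq² is at least d, which outweighs the errors ±2 and
  -- -1 in the norms.
  reduceη : ∀ {p q x y e} → Unit± e →
    norm (+ d) (+ p) (+ q) ≡ -1ℤ → norm (+ d) (+ x) (+ y) ≡ + 2 ℤ.* e → y ℕ.< q →
    ∃₂ λ p′ q′ → norm (+ d) (+ p′) (+ q′) ≡ -1ℤ × q′ ℕ.< q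
  reduceη {p} {q} {x} {y} {e} ±e eqη eqγ y<q = reduce q eqθ eqη bound
    where
    open ℕ.≤-Reasoning
    -- t + w√d = γ² / 2
    t = + d ℤ.* (+ y ℤ.* + y) ℤ.+ e
    w = + x ℤ.* + y

    eqθ : norm (+ d) (+ ∣ t ∣) (+ ∣ w ∣) ≡ 1ℤ
    eqθ = trans (norm-∣∣ (+ d) t w) (trans (norm-def (+ d) t w) (trans (expand (+ d) (+ x) (+ y) e)
      (trans (cong (λ n → e ℤ.* e ℤ.+ (+ 2 ℤ.* e ℤ.- n) ℤ.* (+ d ℤ.* (+ y ℤ.* + y)))
        (trans (sym (norm-def (+ d) (+ x) (+ y))) eqγ))
      (trans (vanish e (+ d ℤ.* (+ y ℤ.* + y))) (e²≡1 ±e)))))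
      where
      expand : ∀ D x y e → (D ℤ.* (y ℤ.* y) ℤ.+ e) ℤ.* (D ℤ.* (y ℤ.* y) ℤ.+ e) ℤ.- D ℤ.* ((x ℤ.* y) ℤ.* (x ℤ.* y))
        ≡ e ℤ.* e ℤ.+ (+ 2 ℤ.* e ℤ.- (x ℤ.* x ℤ.- D ℤ.* (y ℤ.* y))) ℤ.* (D ℤ.* (y ℤ.* y))
      expand = ℤ-RingSolver.solve-∀
      vanish : ∀ e z → e ℤ.* e ℤ.+ (+ 2 ℤ.* e ℤ.- + 2 ℤ.* e) ℤ.* z ≡ e ℤ.* e
      vanish = ℤ-RingSolver.solve-∀
      e²≡1 : ∀ {e} → Unit± e → e ℤ.* e ≡ 1ℤ
      e²≡1 (inj₁ refl) = refl
      e²≡1 (inj₂ refl) = refl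

    1<∣t∣ : 1 ℕ.< ∣ t ∣
    1<∣t∣ = ℕ.+-cancelʳ-≤ 1 2 ∣ t ∣ (begin
      3                           ≤⟨ ℕ.m≤m+n 3 7 ⟩
      10                          ≤⟨ 10≤d*n² (0<y {x} ±e eqγ) ⟩
      d ℕ.* (y ℕ.* y)             ≡⟨ abs-dy² d y ⟨
      ∣ + d ℤ.* (+ y ℤ.* + y) ∣   ≡⟨ cong ∣_∣ (move (+ d ℤ.* (+ y ℤ.* + y)) e) ⟩
      ∣ t ℤ.- e ∣                 ≤⟨ ℤ.∣i-j∣≤∣i∣+∣j∣ t e ⟩
      ∣ t ∣ ℕ.+ ∣ e ∣             ≡⟨ cong (∣ t ∣ ℕ.+_) (∣e∣≡1 ±e) ⟩
      ∣ t ∣ ℕ.+ 1                 ∎)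
      where
      move : ∀ i j → i ≡ i ℤ.+ j ℤ.- j
      move = ℤ-RingSolver.solve-∀
      ∣e∣≡1 : ∀ {e} → Unit± e → ∣ e ∣ ≡ 1
      ∣e∣≡1 (inj₁ refl) = refl
      ∣e∣≡1 (inj₂ refl) = refl

    x<p : x ℕ.< p
    x<p = square-cancel-< (ℕ.+-cancelʳ-< 1 (x ℕ.* x) (p ℕ.* p) (begin-strict
      x ℕ.* x ℕ.+ 1                            ≤⟨ ℕ.+-monoˡ-≤ 1 (norm-upper eqγ) ⟩
      d ℕ.* (y ℕ.* y) ℕ.+ ∣ + 2 ℤ.* e ∣ ℕ.+ 1  ≡⟨ cong (λ t → d ℕ.* (y ℕ.* y) ℕ.+ t ℕ.+ 1) (∣2e∣ ±e) ⟩
      d ℕ.* (y ℕ.* y) ℕ.+ 2 ℕ.+ 1              ≡⟨ ℕ.+-assoc (d ℕ.* (y ℕ.* y)) 2 1 ⟩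
      d ℕ.* (y ℕ.* y) ℕ.+ 3                    <⟨ ℕ.+-monoʳ-< (d ℕ.* (y ℕ.* y)) (ℕ.≤-trans (ℕ.m≤m+n 4 6) 10≤d) ⟩
      d ℕ.* (y ℕ.* y) ℕ.+ d                    ≤⟨ ℕ.m≤m+n _ (2 ℕ.* d ℕ.* y) ⟩
      d ℕ.* (y ℕ.* y) ℕ.+ d ℕ.+ 2 ℕ.* d ℕ.* y  ≡⟨ square-suc d y ⟩
      d ℕ.* (suc y ℕ.* suc y)                  ≤⟨ ℕ.*-monoʳ-≤ d (ℕ.*-mono-≤ y<q y<q) ⟩
      d ℕ.* (q ℕ.* q)                          ≤⟨ norm-lower eqη ⟩
      p ℕ.* p ℕ.+ 1                            ∎))
      where
      square-suc : ∀ d y → d ℕ.* (y ℕ.* y) ℕ.+ d ℕ.+ 2 ℕ.* d ℕ.* y ≡ d ℕ.* (suc y ℕ.* suc y)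
      square-suc = ℕ-RingSolver.solve-∀

    ∣w∣≤p*q : ∣ w ∣ ℕ.≤ p ℕ.* q
    ∣w∣≤p*q = ℕ.≤-trans (ℕ.≤-reflexive (ℤ.abs-* (+ x) (+ y))) (ℕ.*-mono-≤ (ℕ.<⇒≤ x<p) (ℕ.<⇒≤ y<q))

    bound : 1 ℕ.* (q ℕ.* q) ℕ.+ 1 ℕ.* (∣ w ∣ ℕ.* ∣ w ∣) ℕ.< q ℕ.* (q ℕ.* ∣ t ∣ ℕ.+ p ℕ.* ∣ w ∣)
    bound = begin-strict
      1 ℕ.* (q ℕ.* q) ℕ.+ 1 ℕ.* (∣ w ∣ ℕ.* ∣ w ∣)
        <⟨ ℕ.+-mono-<-≤ (subst (ℕ._< q ℕ.* q ℕ.* ∣ t ∣) (ℕ.*-comm (q ℕ.* q) 1) 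
               (ℕ.*-monoʳ-< (q ℕ.* q) {{ℕ.>-nonZero (ℕ.*-mono-≤ 0<q′ 0<q′)}} 1<∣t∣))
             (ℕ.≤-trans (ℕ.≤-reflexive (ℕ.*-identityˡ _)) (ℕ.*-monoˡ-≤ ∣ w ∣ ∣w∣≤p*q)) ⟩
      q ℕ.* q ℕ.* ∣ t ∣ ℕ.+ p ℕ.* q ℕ.* ∣ w ∣
        ≡⟨ collect p q ∣ t ∣ ∣ w ∣ ⟩
      q ℕ.* (q ℕ.* ∣ t ∣ ℕ.+ p ℕ.* ∣ w ∣) ∎
      where
      0<q′ = 0<q {p} eqη
      collect : ∀ p q t w → q ℕ.* q ℕ.* t ℕ.+ p ℕ.* q ℕ.* w ≡ q ℕ.* (q ℕ.* t ℕ.+ p ℕ.* w)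
      collect = ℕ-RingSolver.solve-∀

  -- The sign `e` is left open because division by a unit of norm -1 flips it. Whichever of q and y
  -- is at least as large as the other (y in case of a tie) can be decreased, so q + y is the
  -- measure.
  norm≡-1⇒norm≢±2 : ∀ {p q x y e} → Unit± e →
    norm (+ d) (+ p) (+ q) ≡ -1ℤ → norm (+ d) (+ x) (+ y) ≢ + 2 ℤ.* e
  norm≡-1⇒norm≢±2 {p} {q} {x} {y} ±e eqη eqγ = go p q x y ±e eqη eqγ (<-wellFounded (q ℕ.+ y))
    where
    go : ∀ p q x y {e} → Unit± e →
      norm (+ d) (+ p) (+ q) ≡ -1ℤ → norm (+ d) (+ x) (+ y) ≡ + 2 ℤ.* e →
      Acc ℕ._<_ (q ℕ.+ y) → ⊥
    go p q x y {e} ±e eqη eqγ (acc rec) with q ℕ.≤? y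
    ... | yes q≤y = let x′ , y′ , eqγ′ , y′<y = reduceγ ±e eqη eqγ q≤y in
      go p q x′ y′ (neg ±e) eqη (trans eqγ′ (ℤ.*-assoc (+ 2) e -1ℤ)) (rec (ℕ.+-monoʳ-< q y′<y))
      where
      neg : ∀ {e} → Unit± e → Unit± (e ℤ.* -1ℤ)
      neg (inj₁ refl) = inj₂ refl
      neg (inj₂ refl) = inj₁ refl
    ... | no q≰y = let p′ , q′ , eqη′ , q′<q = reduceη ±e eqη eqγ (ℕ.≰⇒> q≰y) in
      go p′ q′ x y ±e eqη′ eqγ (rec (ℕ.+-monoˡ-< y q′<q))

-- A unit of norm -1

module Unit (b s : ℤ) (k : ℕ) where

  c a n Δ : ℤ
  c = + 4 ℤ.* b ℤ.* s ℤ.+ 1ℤ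
  a = c ℤ.^ k
  n = b ℤ.* a ℤ.+ s
  Δ = a ℤ.+ n ℤ.* n

  -- The terms 4b²n² cancel and 4b(n - ba) + 1 remains, where n - ba = s.
  norm-base : norm Δ (+ 2 ℤ.* b ℤ.* n ℤ.+ 1ℤ) (+ 2 ℤ.* b) ≡ c
  norm-base = trans (norm-def Δ _ (+ 2 ℤ.* b)) (expand b s a)
    where
    expand : ∀ b s a →
      (+ 2 ℤ.* b ℤ.* (b ℤ.* a ℤ.+ s) ℤ.+ 1ℤ) ℤ.* (+ 2 ℤ.* b ℤ.* (b ℤ.* a ℤ.+ s) ℤ.+ 1ℤ)
        ℤ.- (a ℤ.+ (b ℤ.* a ℤ.+ s) ℤ.* (b ℤ.* a ℤ.+ s)) ℤ.* ((+ 2 ℤ.* b) ℤ.* (+ 2 ℤ.* b))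
      ≡ + 4 ℤ.* b ℤ.* s ℤ.+ 1ℤ
    expand = ℤ-RingSolver.solve-∀

  -- A + B√Δ = (2bn + 1 + 2b√Δ)ʲ; the congruence is its image under √Δ ↦ n,
  -- which is a ring homomorphism modulo a because Δ ≡ n².
  power : ∀ j → ∃₂ λ A B → ∃ λ z → norm Δ A B ≡ c ℤ.^ j × A ℤ.+ n ℤ.* B ≡ c ℤ.^ j ℤ.+ a ℤ.* z
  power zero = 1ℤ , 0ℤ , 0ℤ , trans (norm-def Δ 1ℤ 0ℤ) (norm-one Δ) , one n a
    where
    norm-one : ∀ Δ → 1ℤ ℤ.* 1ℤ ℤ.- Δ ℤ.* (0ℤ ℤ.* 0ℤ) ≡ 1ℤ
    norm-one = ℤ-RingSolver.solve-∀
    one : ∀ n a → 1ℤ ℤ.+ n ℤ.* 0ℤ ≡ 1ℤ ℤ.+ a ℤ.* 0ℤ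
    one = ℤ-RingSolver.solve-∀
  power (suc j) =
    let A , B , z , normAB , congAB = power j in
    A ℤ.* (+ 2 ℤ.* b ℤ.* n ℤ.+ 1ℤ) ℤ.+ Δ ℤ.* (B ℤ.* (+ 2 ℤ.* b)) ,
    A ℤ.* (+ 2 ℤ.* b) ℤ.+ B ℤ.* (+ 2 ℤ.* b ℤ.* n ℤ.+ 1ℤ) ,
    -- Under √Δ ↦ n the base becomes 4bn + 1 = c + 4b²a, and replacing Δ by n² leaves the error
    -- a·2bB. The new `z` collects everything that is multiplied by a beyond the leading power of c.
    z ℤ.* (c ℤ.+ + 4 ℤ.* b ℤ.* b ℤ.* a) ℤ.+ + 4 ℤ.* b ℤ.* b ℤ.* c ℤ.^ j ℤ.+ + 2 ℤ.* b ℤ.* B ,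
    trans (norm-* Δ A B _ (+ 2 ℤ.* b)) (trans (cong₂ ℤ._*_ normAB norm-base) (ℤ.*-comm (c ℤ.^ j) c)) ,
    trans (factor b s a A B) (trans
      (cong (λ t → t ℤ.* (c ℤ.+ + 4 ℤ.* b ℤ.* b ℤ.* a) ℤ.+ + 2 ℤ.* b ℤ.* a ℤ.* B) congAB)
      (collect b c a (c ℤ.^ j) z B))
    where
    factor : ∀ b s a A B →
      (A ℤ.* (+ 2 ℤ.* b ℤ.* (b ℤ.* a ℤ.+ s) ℤ.+ 1ℤ)
          ℤ.+ (a ℤ.+ (b ℤ.* a ℤ.+ s) ℤ.* (b ℤ.* a ℤ.+ s)) ℤ.* (B ℤ.* (+ 2 ℤ.* b)))
        ℤ.+ (b ℤ.* a ℤ.+ s) ℤ.* (A ℤ.* (+ 2 ℤ.* b) ℤ.+ B ℤ.* (+ 2 ℤ.* b ℤ.* (b ℤ.* a ℤ.+ s) ℤ.+ 1ℤ))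
      ≡ (A ℤ.+ (b ℤ.* a ℤ.+ s) ℤ.* B) ℤ.* (+ 4 ℤ.* b ℤ.* s ℤ.+ 1ℤ ℤ.+ + 4 ℤ.* b ℤ.* b ℤ.* a) ℤ.+ + 2 ℤ.* b ℤ.* a ℤ.* B
    factor = ℤ-RingSolver.solve-∀
    collect : ∀ b c a cʲ z B →
      (cʲ ℤ.+ a ℤ.* z) ℤ.* (c ℤ.+ + 4 ℤ.* b ℤ.* b ℤ.* a) ℤ.+ + 2 ℤ.* b ℤ.* a ℤ.* B
      ≡ c ℤ.* cʲ ℤ.+ a ℤ.* (z ℤ.* (c ℤ.+ + 4 ℤ.* b ℤ.* b ℤ.* a) ℤ.+ + 4 ℤ.* b ℤ.* b ℤ.* cʲ ℤ.+ + 2 ℤ.* b ℤ.* B)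
    collect = ℤ-RingSolver.solve-∀

  -- The unit is (2bn + 1 + 2b√Δ)ᵏ / (n - √Δ), up to sign.
  ∃-norm≡-1 : a ≢ 0ℤ → ∃₂ λ p q → norm Δ p q ≡ -1ℤ
  ∃-norm≡-1 a≢0 =
    let A , B , z , normAB , congAB = power k in
    -- Division by n - √Δ is multiplication by n + √Δ followed by division by -a. The √Δ-coordinate
    -- A + nB of the product is a(1 + z), as cᵏ = a, and the rational one is nA + ΔB = n(A + nB) +
    -- aB. Division by a gives `q` and `p`.
    let q = 1ℤ ℤ.+ z ; p = n ℤ.* q ℤ.+ B in
    p , q , trans (norm-def Δ p q) (ℤ.*-cancelˡ-≡ a _ -1ℤ {{ℤ.≢-nonZero a≢0}}
      (trans (expand a n B z) (trans (cong (λ t → ℤ.- (t ℤ.* t ℤ.- Δ ℤ.* (B ℤ.* B)))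
         (trans (cong (ℤ._- n ℤ.* B) (sym congAB)) (cancel A (n ℤ.* B))))
        (trans (cong ℤ.-_ (trans (sym (norm-def Δ A B)) normAB)) (negate a)))))
    where
    expand : ∀ a n B z →
      a ℤ.* ((n ℤ.* (1ℤ ℤ.+ z) ℤ.+ B) ℤ.* (n ℤ.* (1ℤ ℤ.+ z) ℤ.+ B)
        ℤ.- (a ℤ.+ n ℤ.* n) ℤ.* ((1ℤ ℤ.+ z) ℤ.* (1ℤ ℤ.+ z)))
      ≡ ℤ.- ((a ℤ.+ a ℤ.* z ℤ.- n ℤ.* B) ℤ.* (a ℤ.+ a ℤ.* z ℤ.- n ℤ.* B) ℤ.- (a ℤ.+ n ℤ.* n) ℤ.* (B ℤ.* B))
    expand = ℤ-RingSolver.solve-∀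
    cancel : ∀ i j → i ℤ.+ j ℤ.- j ≡ i
    cancel = ℤ-RingSolver.solve-∀
    negate : ∀ a → ℤ.- a ≡ a ℤ.* -1ℤ
    negate = ℤ-RingSolver.solve-∀

-- Rational numbers with bounded denominators

coprime-* : ∀ {m n o} → Coprime m n → Coprime m o → Coprime m (n ℕ.* o)
coprime-* {m} {n} {o} m⊥n m⊥o {e} (e∣m , e∣n*o) =
  m⊥o (e∣m , coprime-divisor e⊥n e∣n*o)
  where
  e⊥n : Coprime e n
  e⊥n (f∣e , f∣n) = m⊥n (∣-trans f∣e e∣m , f∣n)

coprime-^ : ∀ {m n} j → Coprime m n → Coprime m (n ℕ.^ j)
coprime-^ zero    m⊥n (_ , e∣1) = ∣1⇒≡1 e∣1
coprime-^ (suc j) m⊥n = coprime-* m⊥n (coprime-^ j m⊥n)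

open RawSemiringDefinitions ℚ.+-*-rawSemiring using () renaming (_^_ to _^ℚ_)

ℚ-ring : AlmostCommutativeRing 0ℓ 0ℓ
ℚ-ring = fromCommutativeRing ℚ.+-*-commutativeRing λ x → dec⇒maybe (0ℚ ℚ.≟ x)

infix 8 _/1
_/1 : ℤ → ℚ
i /1 = i ℚ./ 1

private
  toℚᵘ-/1 : ∀ i → ℚ.toℚᵘ (i /1) ℚᵘ.≃ mkℚᵘ i 0
  toℚᵘ-/1 i = ℚ.toℚᵘ-fromℚᵘ (mkℚᵘ i 0)

/1-homo-+ : ∀ i j → (i ℤ.+ j) /1 ≡ i /1 ℚ.+ j /1
/1-homo-+ i j = ℚ.toℚᵘ-injective (begin
  ℚ.toℚᵘ ((i ℤ.+ j) /1)               ≈⟨ toℚᵘ-/1 (i ℤ.+ j) ⟩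
  mkℚᵘ (i ℤ.+ j) 0                    ≈⟨ ℚᵘ.*≡* (cong (ℤ._* 1ℤ) (sym (cong₂ ℤ._+_ (ℤ.*-identityʳ i) (ℤ.*-identityʳ j)))) ⟩
  mkℚᵘ i 0 ℚᵘ.+ mkℚᵘ j 0              ≈⟨ ℚᵘ.+-cong (toℚᵘ-/1 i) (toℚᵘ-/1 j) ⟨
  ℚ.toℚᵘ (i /1) ℚᵘ.+ ℚ.toℚᵘ (j /1)    ≈⟨ ℚ.toℚᵘ-homo-+ (i /1) (j /1) ⟨
  ℚ.toℚᵘ (i /1 ℚ.+ j /1)              ∎)
  where open ℚᵘ.≃-Reasoning

/1-homo-* : ∀ i j → (i ℤ.* j) /1 ≡ i /1 ℚ.* j /1
/1-homo-* i j = ℚ.toℚᵘ-injective (begin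
  ℚ.toℚᵘ ((i ℤ.* j) /1)               ≈⟨ toℚᵘ-/1 (i ℤ.* j) ⟩
  mkℚᵘ i 0 ℚᵘ.* mkℚᵘ j 0              ≈⟨ ℚᵘ.*-cong (toℚᵘ-/1 i) (toℚᵘ-/1 j) ⟨
  ℚ.toℚᵘ (i /1) ℚᵘ.* ℚ.toℚᵘ (j /1)    ≈⟨ ℚ.toℚᵘ-homo-* (i /1) (j /1) ⟨
  ℚ.toℚᵘ (i /1 ℚ.* j /1)              ∎)
  where open ℚᵘ.≃-Reasoning

/1-homo-neg : ∀ i → (ℤ.- i) /1 ≡ ℚ.- (i /1)
/1-homo-neg i = ℚ.toℚᵘ-injective (begin
  ℚ.toℚᵘ ((ℤ.- i) /1)     ≈⟨ toℚᵘ-/1 (ℤ.- i) ⟩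
  ℚᵘ.- mkℚᵘ i 0           ≈⟨ ℚᵘ.-‿cong (toℚᵘ-/1 i) ⟨
  ℚᵘ.- ℚ.toℚᵘ (i /1)      ≈⟨ ℚ.toℚᵘ-homo‿- (i /1) ⟨
  ℚ.toℚᵘ (ℚ.- (i /1))     ∎)
  where open ℚᵘ.≃-Reasoning

/1-injective : ∀ {i j} → i /1 ≡ j /1 → i ≡ j
/1-injective {i} {j} eq with ℚ./-injective-≃ (mkℚᵘ i 0) (mkℚᵘ j 0) eq
... | ℚᵘ.*≡* eq′ = ℤ.*-cancelʳ-≡ i j 1ℤ eq′

/1-homo-norm : ∀ D x y → norm D x y /1 ≡ x /1 ℚ.* x /1 ℚ.- D /1 ℚ.* (y /1 ℚ.* y /1)
/1-homo-norm D x y = trans (cong _/1 (norm-def D x y))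
  (trans (/1-homo-+ (x ℤ.* x) _) (cong₂ ℚ._+_ (/1-homo-* x x)
    (trans (/1-homo-neg (D ℤ.* (y ℤ.* y))) (cong ℚ.-_
      (trans (/1-homo-* D (y ℤ.* y)) (cong (D /1 ℚ.*_) (/1-homo-* y y)))))))

↧-* : ∀ x → (↧ x) /1 ℚ.* x ≡ (↥ x) /1
↧-* x@(mkℚ n d-1 _) = ℚ.toℚᵘ-injective (begin
  ℚ.toℚᵘ ((↧ x) /1 ℚ.* x)         ≈⟨ ℚ.toℚᵘ-homo-* ((↧ x) /1) x ⟩
  ℚ.toℚᵘ ((↧ x) /1) ℚᵘ.* mkℚᵘ n d-1  ≈⟨ ℚᵘ.*-congʳ (toℚᵘ-/1 (↧ x)) ⟩
  mkℚᵘ (↧ x) 0 ℚᵘ.* mkℚᵘ n d-1    ≈⟨ ℚᵘ.*≡* (swap (↧ x) n (+ (1 ℕ.* suc d-1)) (cong +_ (ℕ.*-identityˡ (suc d-1)))) ⟩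
  mkℚᵘ n 0                        ≈⟨ toℚᵘ-/1 n ⟨
  ℚ.toℚᵘ (n /1)                   ∎)
  where
  open ℚᵘ.≃-Reasoning
  swap : ∀ e n e′ → e′ ≡ e → e ℤ.* n ℤ.* 1ℤ ≡ n ℤ.* e′
  swap e n _ refl = trans (ℤ.*-identityʳ _) (ℤ.*-comm e n)

Integral : Pred ℚ 0ℓ
Integral x = ∃ λ i → x ≡ i /1

↧≡1⇒integral : ∀ {x} → ↧ₙ x ≡ 1 → Integral x
↧≡1⇒integral {x} ↧≡1 = ↥ x , (begin
  x                     ≡⟨ ℚ.*-identityˡ x ⟨
  1ℚ ℚ.* x              ≡⟨ cong (λ n → (+ n) /1 ℚ.* x) ↧≡1 ⟨
  (↧ x) /1 ℚ.* x        ≡⟨ ↧-* x ⟩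
  (↥ x) /1              ∎)
  where open ≡-Reasoning

↧-^ : ∀ x j → (+ (↧ₙ x ℕ.^ j)) /1 ℚ.* x ^ℚ j ≡ (↥ x ℤ.^ j) /1
↧-^ x zero = refl
↧-^ x (suc j) = begin
  (+ (e ℕ.* e ℕ.^ j)) /1 ℚ.* (x ℚ.* x ^ℚ j)             ≡⟨ cong (λ i → i /1 ℚ.* (x ℚ.* x ^ℚ j)) (ℤ.pos-* e (e ℕ.^ j)) ⟩
  (+ e ℤ.* + (e ℕ.^ j)) /1 ℚ.* (x ℚ.* x ^ℚ j)           ≡⟨ cong (ℚ._* (x ℚ.* x ^ℚ j)) (/1-homo-* (+ e) (+ (e ℕ.^ j))) ⟩
  (+ e) /1 ℚ.* (+ (e ℕ.^ j)) /1 ℚ.* (x ℚ.* x ^ℚ j)      ≡⟨ interchange ((+ e) /1) ((+ (e ℕ.^ j)) /1) x (x ^ℚ j) ⟩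
  (+ e) /1 ℚ.* x ℚ.* ((+ (e ℕ.^ j)) /1 ℚ.* x ^ℚ j)      ≡⟨ cong₂ ℚ._*_ (↧-* x) (↧-^ x j) ⟩
  (↥ x) /1 ℚ.* (↥ x ℤ.^ j) /1                           ≡⟨ /1-homo-* (↥ x) (↥ x ℤ.^ j) ⟨
  (↥ x ℤ.* ↥ x ℤ.^ j) /1                                ∎
  where
  open ≡-Reasoning
  e = ↧ₙ x
  interchange : ∀ a b c d → a ℚ.* b ℚ.* (c ℚ.* d) ≡ a ℚ.* c ℚ.* (b ℚ.* d)
  interchange = solve-∀ ℚ-ring

abs-^ : ∀ i j → ∣ i ℤ.^ j ∣ ≡ ∣ i ∣ ℕ.^ j
abs-^ i zero    = refl
abs-^ i (suc j) = trans (ℤ.abs-* i (i ℤ.^ j)) (cong (∣ i ∣ ℕ.*_) (abs-^ i j))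

-- Powers of coprime numbers are coprime, so xʲ in lowest terms has the j-th power of the
-- denominator of x below the line, and `m` must absorb all of it.
↧^j∣m : ∀ m x j → Integral ((+ m) /1 ℚ.* x ^ℚ j) → ↧ₙ x ℕ.^ j ∣ m
↧^j∣m m x@(mkℚ r e-1 coprime) j (z , eq) =
  coprime-divisor eʲ⊥rʲ (divides ∣ z ∣ (trans (ℕ.*-comm (∣ r ∣ ℕ.^ j) m) (begin
    m ℕ.* ∣ r ∣ ℕ.^ j       ≡⟨ cong (m ℕ.*_) (abs-^ r j) ⟨
    m ℕ.* ∣ r ℤ.^ j ∣       ≡⟨ ℤ.abs-* (+ m) (r ℤ.^ j) ⟨
    ∣ + m ℤ.* r ℤ.^ j ∣     ≡⟨ cong ∣_∣ (/1-injective {+ m ℤ.* r ℤ.^ j} {z ℤ.* + (e ℕ.^ j)} m*rʲ≡z*eʲ) ⟩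
    ∣ z ℤ.* + (e ℕ.^ j) ∣   ≡⟨ ℤ.abs-* z (+ (e ℕ.^ j)) ⟩
    ∣ z ∣ ℕ.* e ℕ.^ j       ∎)))
  where
  open ≡-Reasoning
  e = suc e-1
  eʲ⊥rʲ : Coprime (e ℕ.^ j) (∣ r ∣ ℕ.^ j)
  eʲ⊥rʲ = coprime-^ j (Coprimality.sym (coprime-^ j (Coprimality.recompute coprime)))
  swap : ∀ a b c → a ℚ.* (b ℚ.* c) ≡ a ℚ.* c ℚ.* b
  swap = solve-∀ ℚ-ring
  m*rʲ≡z*eʲ : (+ m ℤ.* r ℤ.^ j) /1 ≡ (z ℤ.* + (e ℕ.^ j)) /1
  m*rʲ≡z*eʲ = begin
    (+ m ℤ.* r ℤ.^ j) /1                         ≡⟨ /1-homo-* (+ m) (r ℤ.^ j) ⟩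
    (+ m) /1 ℚ.* (r ℤ.^ j) /1                    ≡⟨ cong ((+ m) /1 ℚ.*_) (↧-^ x j) ⟨
    (+ m) /1 ℚ.* ((+ (e ℕ.^ j)) /1 ℚ.* x ^ℚ j)   ≡⟨ swap ((+ m) /1) ((+ (e ℕ.^ j)) /1) (x ^ℚ j) ⟩
    (+ m) /1 ℚ.* x ^ℚ j ℚ.* (+ (e ℕ.^ j)) /1     ≡⟨ cong (ℚ._* (+ (e ℕ.^ j)) /1) eq ⟩
    z /1 ℚ.* (+ (e ℕ.^ j)) /1                    ≡⟨ /1-homo-* z (+ (e ℕ.^ j)) ⟨
    (z ℤ.* + (e ℕ.^ j)) /1                       ∎

-- The square of the denominator divides `m`. With m = d this controls the √d-coordinate of an
-- integral element; with m = 1 it makes a rational square root of an integer an integer.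
squarefree⇒integral : ∀ {m x} → Squarefree m → Integral ((+ m) /1 ℚ.* (x ℚ.* x)) → Integral x
squarefree⇒integral {m} {x} sf (z , eq) = ↧≡1⇒integral {x} (sf (↧ₙ x)
  (subst (λ t → ↧ₙ x ℕ.* t ∣ m) (ℕ.*-identityʳ (↧ₙ x))
    (↧^j∣m m x 2 (z , trans (cong (λ t → (+ m) /1 ℚ.* (x ℚ.* t)) (ℚ.*-identityʳ x)) eq))))

-- This is complete integral closedness of ℤ. A denominator e ≥ 2 is refuted by the exponent j = m:
-- eᵐ would divide m although eᵐ > m.
bounded⇒integral : ∀ m x .{{_ : ℕ.NonZero m}} →
  (∀ j → Integral ((+ m) /1 ℚ.* x ^ℚ j)) → Integral x
bounded⇒integral m x bounded with ↧ₙ x ℕ.≤? 1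
... | yes ↧≤1 = ↧≡1⇒integral {x} (ℕ.≤-antisym ↧≤1 (1≤↧ x))
  where
  1≤↧ : ∀ x → 1 ℕ.≤ ↧ₙ x
  1≤↧ (mkℚ _ _ _) = s≤s z≤n
... | no ↧≰1 = contradiction (∣⇒≤ (↧^j∣m m x m (bounded m))) (ℕ.<⇒≱ (n<e^n m))
  where
  n<e^n : ∀ n → n ℕ.< ↧ₙ x ℕ.^ n
  n<e^n zero    = s≤s z≤n
  n<e^n (suc n) = ℕ.≤-<-trans (n<e^n n) (ℕ.^-monoʳ-< (↧ₙ x) (ℕ.≰⇒> ↧≰1) (ℕ.n<1+n n))

-- The ring of integers

module Field (d : ℕ) where

  open RawRing (ℚ√-rawRing d) public using (_*_; 0#; 1#; -_) renaming (_+_ to _⊕_)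
  open RawSemiringDefinitions (RawRing.rawSemiring (ℚ√-rawRing d)) public using (sum; _^_)

  private
    dℚ : ℚ
    dℚ = (+ d) /1

    rational-assoc : ∀ D x y u v p q →
      (x ℚ.* u ℚ.+ D ℚ.* (y ℚ.* v)) ℚ.* p ℚ.+ D ℚ.* ((x ℚ.* v ℚ.+ y ℚ.* u) ℚ.* q)
      ≡ x ℚ.* (u ℚ.* p ℚ.+ D ℚ.* (v ℚ.* q)) ℚ.+ D ℚ.* (y ℚ.* (u ℚ.* q ℚ.+ v ℚ.* p))
    rational-assoc = solve-∀ ℚ-ring

    irrational-assoc : ∀ D x y u v p q →
      (x ℚ.* u ℚ.+ D ℚ.* (y ℚ.* v)) ℚ.* q ℚ.+ (x ℚ.* v ℚ.+ y ℚ.* u) ℚ.* p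
      ≡ x ℚ.* (u ℚ.* q ℚ.+ v ℚ.* p) ℚ.+ y ℚ.* (u ℚ.* p ℚ.+ D ℚ.* (v ℚ.* q))
    irrational-assoc = solve-∀ ℚ-ring

    rational-comm : ∀ D x y u v → x ℚ.* u ℚ.+ D ℚ.* (y ℚ.* v) ≡ u ℚ.* x ℚ.+ D ℚ.* (v ℚ.* y)
    rational-comm = solve-∀ ℚ-ring

    irrational-comm : ∀ x y u v → x ℚ.* v ℚ.+ y ℚ.* u ≡ u ℚ.* y ℚ.+ v ℚ.* x
    irrational-comm = solve-∀ ℚ-ring

    rational-identity : ∀ D x y → 1ℚ ℚ.* x ℚ.+ D ℚ.* (0ℚ ℚ.* y) ≡ x
    rational-identity = solve-∀ ℚ-ring

    irrational-identity : ∀ x y → 1ℚ ℚ.* y ℚ.+ 0ℚ ℚ.* x ≡ y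
    irrational-identity = solve-∀ ℚ-ring

    rational-distrib : ∀ D x y u v p q →
      x ℚ.* (u ℚ.+ p) ℚ.+ D ℚ.* (y ℚ.* (v ℚ.+ q))
      ≡ x ℚ.* u ℚ.+ D ℚ.* (y ℚ.* v) ℚ.+ (x ℚ.* p ℚ.+ D ℚ.* (y ℚ.* q))
    rational-distrib = solve-∀ ℚ-ring

    irrational-distrib : ∀ x y u v p q →
      x ℚ.* (v ℚ.+ q) ℚ.+ y ℚ.* (u ℚ.+ p)
      ≡ x ℚ.* v ℚ.+ y ℚ.* u ℚ.+ (x ℚ.* q ℚ.+ y ℚ.* p)
    irrational-distrib = solve-∀ ℚ-ring

    *-comm : ∀ α β → α * β ≡ β * α
    *-comm (x + y √) (u + v √) = cong₂ _+_√ (rational-comm dℚ x y u v) (irrational-comm x y u v)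

    *-identityˡ : ∀ α → 1# * α ≡ α
    *-identityˡ (x + y √) = cong₂ _+_√ (rational-identity dℚ x y) (irrational-identity x y)

    distribˡ : ∀ α β γ → α * (β ⊕ γ) ≡ (α * β) ⊕ (α * γ)
    distribˡ (x + y √) (u + v √) (p + q √) =
      cong₂ _+_√ (rational-distrib dℚ x y u v p q) (irrational-distrib x y u v p q)

  isCommutativeRing : IsCommutativeRing _≡_ _⊕_ _*_ -_ 0# 1#
  isCommutativeRing = record
    { isRing = record
      { +-isAbelianGroup = record
        { isGroup = record
          { isMonoid = record
            { isSemigroup = record
              { isMagma = record { isEquivalence = isEquivalence ; ∙-cong = cong₂ _⊕_ }
              ; assoc = λ { (x + y √) (u + v √) (p + q √) → cong₂ _+_√ (ℚ.+-assoc x u p) (ℚ.+-assoc y v q) }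
              }
            ; identity = (λ { (x + y √) → cong₂ _+_√ (ℚ.+-identityˡ x) (ℚ.+-identityˡ y) })
                       , (λ { (x + y √) → cong₂ _+_√ (ℚ.+-identityʳ x) (ℚ.+-identityʳ y) })
            }
          ; inverse = (λ { (x + y √) → cong₂ _+_√ (ℚ.+-inverseˡ x) (ℚ.+-inverseˡ y) })
                    , (λ { (x + y √) → cong₂ _+_√ (ℚ.+-inverseʳ x) (ℚ.+-inverseʳ y) })
          ; ⁻¹-cong = cong (-_)
          }
        ; comm = λ { (x + y √) (u + v √) → cong₂ _+_√ (ℚ.+-comm x u) (ℚ.+-comm y v) }
        }
      ; *-cong = cong₂ _*_
      ; *-assoc = λ { (x + y √) (u + v √) (p + q √) →
          cong₂ _+_√ (rational-assoc dℚ x y u v p q) (irrational-assoc dℚ x y u v p q) }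
      ; *-identity = *-identityˡ , λ α → trans (*-comm α 1#) (*-identityˡ α)
      ; distrib = distribˡ , λ α β γ → trans (*-comm (β ⊕ γ) α)
          (trans (distribˡ α β γ) (cong₂ _⊕_ (*-comm α β) (*-comm α γ)))
      }
    ; *-comm = *-comm
    }

-- Integral elements have integral norms

module Integrality (d : ℕ) where

  open Field d

  commutativeRing : CommutativeRing 0ℓ 0ℓ
  commutativeRing = record { isCommutativeRing = isCommutativeRing }

  open CommutativeRing commutativeRing
    using (*-assoc; *-identityˡ; *-identityʳ; zeroˡ; zeroʳ; distribˡ; distribʳ; *-commutativeSemigroup; ring)
  open CommutativeSemigroupProperties *-commutativeSemigroup using (x∙yz≈y∙xz)
  open RingProperties ring using (-‿distribˡ-*; -‿distribʳ-*; +-inverseˡ-unique)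
  open ≡-Reasoning

  dℚ : ℚ
  dℚ = (+ d) /1

  ℤ√ : Pred (ℚ[√ d ]) 0ℓ
  ℤ√ α = ∃₂ λ p q → α ≡ (p /1) + (q /1) √

  0∈ℤ√ : 0# ∈ ℤ√
  0∈ℤ√ = 0ℤ , 0ℤ , refl

  fromℤ∈ℤ√ : ∀ i → fromℤ d i ∈ ℤ√
  fromℤ∈ℤ√ i = i , 0ℤ , refl

  ⊕-closed : ∀ {α β} → α ∈ ℤ√ → β ∈ ℤ√ → (α ⊕ β) ∈ ℤ√
  ⊕-closed (p , q , α≡) (r , s , β≡) =
    p ℤ.+ r , q ℤ.+ s , trans (cong₂ _⊕_ α≡ β≡) (sym (cong₂ _+_√ (/1-homo-+ p r) (/1-homo-+ q s)))

  neg-closed : ∀ {α} → α ∈ ℤ√ → (- α) ∈ ℤ√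
  neg-closed (p , q , α≡) = ℤ.- p , ℤ.- q , trans (cong -_ α≡) (sym (cong₂ _+_√ (/1-homo-neg p) (/1-homo-neg q)))

  *-closed : ∀ {α β} → α ∈ ℤ√ → β ∈ ℤ√ → (α * β) ∈ ℤ√
  *-closed (p , q , α≡) (r , s , β≡) =
    p ℤ.* r ℤ.+ + d ℤ.* (q ℤ.* s) , p ℤ.* s ℤ.+ q ℤ.* r , trans (cong₂ _*_ α≡ β≡) (sym (cong₂ _+_√
      (trans (/1-homo-+ (p ℤ.* r) (+ d ℤ.* (q ℤ.* s)))
        (cong₂ ℚ._+_ (/1-homo-* p r) (trans (/1-homo-* (+ d) (q ℤ.* s)) (cong (dℚ ℚ.*_) (/1-homo-* q s)))))
      (trans (/1-homo-+ (p ℤ.* s) (q ℤ.* r)) (cong₂ ℚ._+_ (/1-homo-* p s) (/1-homo-* q r)))))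

  N : ℚ[√ d ] → ℚ
  N (x + y √) = x ℚ.* x ℚ.- dℚ ℚ.* (y ℚ.* y)

  N-* : ∀ α β → N (α * β) ≡ N α ℚ.* N β
  N-* (x + y √) (u + v √) = expand dℚ x y u v
    where
    expand : ∀ D x y u v →
      (x ℚ.* u ℚ.+ D ℚ.* (y ℚ.* v)) ℚ.* (x ℚ.* u ℚ.+ D ℚ.* (y ℚ.* v))
        ℚ.- D ℚ.* ((x ℚ.* v ℚ.+ y ℚ.* u) ℚ.* (x ℚ.* v ℚ.+ y ℚ.* u))
      ≡ (x ℚ.* x ℚ.- D ℚ.* (y ℚ.* y)) ℚ.* (u ℚ.* u ℚ.- D ℚ.* (v ℚ.* v))
    expand = solve-∀ ℚ-ring

  N-rational : ∀ x → N (x + 0ℚ √) ≡ x ℚ.* x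
  N-rational x = expand dℚ x
    where
    expand : ∀ D x → x ℚ.* x ℚ.- D ℚ.* (0ℚ ℚ.* 0ℚ) ≡ x ℚ.* x
    expand = solve-∀ ℚ-ring

  N-^ : ∀ α j → N (α ^ j) ≡ N α ^ℚ j
  N-^ α zero    = N-rational 1ℚ
  N-^ α (suc j) = trans (N-* α (α ^ j)) (cong (N α ℚ.*_) (N-^ α j))

  N-ℤ√ : ∀ p q → N ((p /1) + (q /1) √) ≡ norm (+ d) p q /1
  N-ℤ√ p q = sym (/1-homo-norm (+ d) p q)

  N-integral : ∀ {α} → α ∈ ℤ√ → Integral (N α)
  N-integral (p , q , refl) = norm (+ d) p q , N-ℤ√ p q

  -- Norms are multiplicative and N(m) = m², so a common denominator `m` for the powers of α becomes
  -- the common denominator m² for the powers of its norm.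
  bounded⇒N-integral : ∀ m α .{{_ : ℕ.NonZero m}} →
    (∀ j → (fromℤ d (+ m) * (α ^ j)) ∈ ℤ√) → Integral (N α)
  bounded⇒N-integral m α bounded = bounded⇒integral (m ℕ.* m) (N α) {{ℕ.m*n≢0 m m}} λ j →
    let i , eq = N-integral (bounded j) in i , (begin
      (+ (m ℕ.* m)) /1 ℚ.* N α ^ℚ j
        ≡⟨ cong₂ ℚ._*_ (trans (cong _/1 (ℤ.pos-* m m)) (/1-homo-* (+ m) (+ m))) (sym (N-^ α j)) ⟩
      (+ m) /1 ℚ.* (+ m) /1 ℚ.* N (α ^ j)   ≡⟨ cong (ℚ._* N (α ^ j)) (N-rational ((+ m) /1)) ⟨
      N (fromℤ d (+ m)) ℚ.* N (α ^ j)       ≡⟨ N-* (fromℤ d (+ m)) (α ^ j) ⟨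
      N (fromℤ d (+ m) * (α ^ j))           ≡⟨ eq ⟩
      i /1                                  ∎)

  denominator : ∀ α → ∃ λ m → ℕ.NonZero m × (fromℤ d (+ m) * α) ∈ ℤ√
  denominator (x@(mkℚ _ _ _) + y@(mkℚ _ _ _) √) = ↧ₙ x ℕ.* ↧ₙ y , ℕ.m*n≢0 (↧ₙ x) (↧ₙ y) ,
    ↥ x ℤ.* ↧ y , ↥ y ℤ.* ↧ x , cong₂ _+_√
      (begin
        (↧ x ℤ.* ↧ y) /1 ℚ.* x ℚ.+ dℚ ℚ.* (0ℚ ℚ.* y)       ≡⟨ cong (λ t → t ℚ.* x ℚ.+ dℚ ℚ.* (0ℚ ℚ.* y)) (/1-homo-* (↧ x) (↧ y)) ⟩
        (↧ x) /1 ℚ.* (↧ y) /1 ℚ.* x ℚ.+ dℚ ℚ.* (0ℚ ℚ.* y)  ≡⟨ rational-part dℚ ((↧ x) /1) ((↧ y) /1) x y ⟩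
        (↧ x) /1 ℚ.* x ℚ.* (↧ y) /1                        ≡⟨ cong (ℚ._* (↧ y) /1) (↧-* x) ⟩
        (↥ x) /1 ℚ.* (↧ y) /1                              ≡⟨ /1-homo-* (↥ x) (↧ y) ⟨
        (↥ x ℤ.* ↧ y) /1                                   ∎)
      (begin
        (↧ x ℤ.* ↧ y) /1 ℚ.* y ℚ.+ 0ℚ ℚ.* x                ≡⟨ cong (λ t → t ℚ.* y ℚ.+ 0ℚ ℚ.* x) (/1-homo-* (↧ x) (↧ y)) ⟩
        (↧ x) /1 ℚ.* (↧ y) /1 ℚ.* y ℚ.+ 0ℚ ℚ.* x           ≡⟨ irrational-part ((↧ x) /1) ((↧ y) /1) x y ⟩
        (↧ y) /1 ℚ.* y ℚ.* (↧ x) /1                        ≡⟨ cong (ℚ._* (↧ x) /1) (↧-* y) ⟩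
        (↥ y) /1 ℚ.* (↧ x) /1                              ≡⟨ /1-homo-* (↥ y) (↧ x) ⟨
        (↥ y ℤ.* ↧ x) /1                                   ∎)
    where
    rational-part : ∀ D e f x y → e ℚ.* f ℚ.* x ℚ.+ D ℚ.* (0ℚ ℚ.* y) ≡ e ℚ.* x ℚ.* f
    rational-part = solve-∀ ℚ-ring
    irrational-part : ∀ e f x y → e ℚ.* f ℚ.* y ℚ.+ 0ℚ ℚ.* x ≡ f ℚ.* y ℚ.* e
    irrational-part = solve-∀ ℚ-ring

  fromℤ-* : ∀ i j → fromℤ d (i ℤ.* j) ≡ fromℤ d i * fromℤ d j
  fromℤ-* i j = cong₂ _+_√ (trans (/1-homo-* i j) (expand dℚ (i /1) (j /1))) (sym (vanish (i /1) (j /1)))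
    where
    expand : ∀ D x y → x ℚ.* y ≡ x ℚ.* y ℚ.+ D ℚ.* (0ℚ ℚ.* 0ℚ)
    expand = solve-∀ ℚ-ring
    vanish : ∀ x y → x ℚ.* 0ℚ ℚ.+ 0ℚ ℚ.* y ≡ 0ℚ
    vanish = solve-∀ ℚ-ring

  common-denominator : ∀ n (f : ℕ → ℚ[√ d ]) →
    ∃ λ m → ℕ.NonZero m × (∀ i → i ℕ.< n → (fromℤ d (+ m) * f i) ∈ ℤ√)
  common-denominator zero f = 1 , _ , λ _ ()
  common-denominator (suc n) f with common-denominator n f | denominator (f n)
  ... | m , m≢0 , m-clears | e , e≢0 , e-clears =
    m ℕ.* e , ℕ.m*n≢0 m e {{m≢0}} {{e≢0}} , 
    λ i i<1+n → subst (_∈ ℤ√) (sym (split i)) (clears i (ℕ.m<1+n⇒m<n∨m≡n i<1+n))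
    where
    split : ∀ i → fromℤ d (+ (m ℕ.* e)) * f i ≡ fromℤ d (+ m) * (fromℤ d (+ e) * f i)
    split i = trans (cong (_* f i) (trans (cong (fromℤ d) (ℤ.pos-* m e)) (fromℤ-* (+ m) (+ e))))
      (*-assoc (fromℤ d (+ m)) (fromℤ d (+ e)) (f i))
    clears : ∀ i → i ℕ.< n ⊎ i ≡ n → (fromℤ d (+ m) * (fromℤ d (+ e) * f i)) ∈ ℤ√
    clears i (inj₁ i<n)  = subst (_∈ ℤ√) (x∙yz≈y∙xz (fromℤ d (+ e)) (fromℤ d (+ m)) (f i))
      (*-closed (fromℤ∈ℤ√ (+ e)) (m-clears i i<n))
    clears i (inj₂ refl) = *-closed (fromℤ∈ℤ√ (+ m)) e-clears

  sum-closed : ∀ m {n} (c : Vector ℤ n) (g : Vector (ℚ[√ d ]) n) z →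
    (∀ i → (m * (g i * z)) ∈ ℤ√) → (m * (sum (λ i → fromℤ d (c i) * g i) * z)) ∈ ℤ√
  sum-closed m {zero} c g z closed = subst (_∈ ℤ√) (sym (trans (cong (m *_) (zeroˡ z)) (zeroʳ m))) 0∈ℤ√
  sum-closed m {suc n} c g z closed =
    subst (_∈ ℤ√) (sym eq) (⊕-closed (*-closed (fromℤ∈ℤ√ (c zero)) (closed zero))
      (sum-closed m (λ i → c (suc i)) (λ i → g (suc i)) z (λ i → closed (suc i))))
    where
    k = fromℤ d (c zero)
    s = sum (λ i → fromℤ d (c (suc i)) * g (suc i))
    eq : m * (((k * g zero) ⊕ s) * z) ≡ (k * (m * (g zero * z))) ⊕ (m * (s * z))
    eq = begin
      m * (((k * g zero) ⊕ s) * z)                 ≡⟨ cong (m *_) (distribʳ z (k * g zero) s) ⟩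
      m * (((k * g zero) * z) ⊕ (s * z))           ≡⟨ distribˡ m _ _ ⟩
      (m * ((k * g zero) * z)) ⊕ (m * (s * z))     ≡⟨ cong (λ t → (m * t) ⊕ (m * (s * z))) (*-assoc k (g zero) z) ⟩
      (m * (k * (g zero * z))) ⊕ (m * (s * z))     ≡⟨ cong (_⊕ (m * (s * z))) (x∙yz≈y∙xz m k (g zero * z)) ⟩
      (k * (m * (g zero * z))) ⊕ (m * (s * z))     ∎

  module Root {α : ℚ[√ d ]} {n} (c : Vector ℤ n)
    (root : (α ^ n) ⊕ sum (λ i → fromℤ d (c i) * (α ^ toℕ i)) ≡ 0#) where

    module _ (m : ℚ[√ d ]) where

      -- m clears the denominators of z ℤ[α].
      Cleared : Pred (ℚ[√ d ]) 0ℓ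
      Cleared z = ∀ i → i ℕ.< n → (m * ((α ^ i) * z)) ∈ ℤ√

      Cleared-⊕ : ∀ {z w} → Cleared z → Cleared w → Cleared (z ⊕ w)
      Cleared-⊕ {z} {w} z-cleared w-cleared i i<n =
        subst (_∈ ℤ√) (sym (trans (cong (m *_) (distribˡ (α ^ i) z w)) (distribˡ m _ _)))
          (⊕-closed (z-cleared i i<n) (w-cleared i i<n))

      -- Multiplication by α shifts the exponents by one. Only αⁿ leaves the range, and the
      -- polynomial equation turns it into an integer combination of lower powers, so the
      -- denominators do not grow.
      Cleared-α* : ∀ {z} → Cleared z → Cleared (α * z)
      Cleared-α* {z} z-cleared i i<n =
        subst (λ t → (m * t) ∈ ℤ√) (trans (*-assoc α (α ^ i) z) (x∙yz≈y∙xz α (α ^ i) z))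
          (next (suc i) (ℕ.m≤n⇒m<n∨m≡n i<n))
        where
        next : ∀ j → j ℕ.< n ⊎ j ≡ n → (m * ((α ^ j) * z)) ∈ ℤ√
        next j (inj₁ j<n)  = z-cleared j j<n
        next j (inj₂ refl) = subst (_∈ ℤ√) (sym eq)
          (neg-closed (sum-closed m c (λ i → α ^ toℕ i) z (λ i → z-cleared (toℕ i) (Fin.toℕ<n i))))
          where
          s = sum (λ i → fromℤ d (c i) * (α ^ toℕ i))
          eq : m * ((α ^ n) * z) ≡ - (m * (s * z))
          eq = begin
            m * ((α ^ n) * z)  ≡⟨ cong (λ t → m * (t * z)) (+-inverseˡ-unique (α ^ n) s root) ⟩
            m * ((- s) * z)    ≡⟨ cong (m *_) (-‿distribˡ-* s z) ⟨
            m * (- (s * z))    ≡⟨ -‿distribʳ-* m (s * z) ⟨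
            - (m * (s * z))    ∎

    -- A common denominator of 1, α, ..., αⁿ⁻¹ clears 1 in the sense of `Cleared`. Multiplication by
    -- α and by α + 1 both preserve this, so the same denominator serves all powers of both
    -- elements.
    root-N-integral : Integral (N α) × Integral (N (α ⊕ 1#))
    root-N-integral with common-denominator n (α ^_)
    ... | m , m≢0 , clears =
      bounded⇒N-integral m α {{m≢0}} (λ j → bounded (powers α (Cleared-α* M) j)) ,
      bounded⇒N-integral m (α ⊕ 1#) {{m≢0}} (λ j → bounded (powers (α ⊕ 1#) step j))
      where
      M = fromℤ d (+ m)
      step : ∀ {z} → Cleared M z → Cleared M ((α ⊕ 1#) * z)
      step {z} z-cleared = subst (Cleared M) (sym (trans (distribʳ z α 1#) (cong ((α * z) ⊕_) (*-identityˡ z))))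
        (Cleared-⊕ M (Cleared-α* M z-cleared) z-cleared)
      powers : ∀ β → (∀ {z} → Cleared M z → Cleared M (β * z)) → ∀ j → Cleared M (β ^ j)
      powers β closed zero i i<n = subst (λ t → (M * t) ∈ ℤ√) (sym (*-identityʳ (α ^ i))) (clears i i<n)
      powers β closed (suc j) = closed (powers β closed j)
      -- The exponent 0 must be available to read `M * z` off `Cleared`, which is vacuous for n = 0;
      -- in that case the equation would be 1 = 0.
      0<n : ∀ {n} (c : Vector ℤ n) → (α ^ n) ⊕ sum (λ i → fromℤ d (c i) * (α ^ toℕ i)) ≡ 0# → 0 ℕ.< n
      0<n {zero} _ ()
      0<n {suc _} _ _ = ℕ.z<s
      bounded : ∀ {z} → Cleared M z → (M * z) ∈ ℤ√
      bounded {z} z-cleared = subst (λ t → (M * t) ∈ ℤ√) (*-identityˡ z) (z-cleared 0 (0<n c root))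

-- Parity, and the integers of the field when d is 2 modulo 4

even-square⇒even : ∀ i j → i ℤ.* i ≡ + 2 ℤ.* j → ∃ λ k → i ≡ + 2 ℤ.* k
even-square⇒even i j eq
  with ℤ.∣ᵤ⇒∣ {+ 2} {i} (Sum.reduce (euclidsLemma ∣ i ∣ ∣ i ∣ prime[2] (divides ∣ j ∣ (begin
    ∣ i ∣ ℕ.* ∣ i ∣    ≡⟨ ℤ.abs-* i i ⟨
    ∣ i ℤ.* i ∣        ≡⟨ cong ∣_∣ eq ⟩
    ∣ + 2 ℤ.* j ∣      ≡⟨ ℤ.abs-* (+ 2) j ⟩
    2 ℕ.* ∣ j ∣        ≡⟨ ℕ.*-comm 2 ∣ j ∣ ⟩
    ∣ j ∣ ℕ.* 2        ∎))))
  where open ≡-Reasoning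
... | ℤ.divides k i≡k*2 = k , trans i≡k*2 (ℤ.*-comm k (+ 2))

odd⇒2r+1 : ∀ {n} → Odd n → ∃ λ r → n ≡ 2 ℕ.* r ℕ.+ 1
odd⇒2r+1 {n} odd with n ℕ.% 2 in n%2 | m%n<n n 2
... | 0 | _ = contradiction (m%n≡0⇒n∣m n 2 n%2) odd
... | 1 | _ = n ℕ./ 2 , trans (m≡m%n+[m/n]*n n 2) (trans (cong (ℕ._+ n ℕ./ 2 ℕ.* 2) n%2)
  (trans (ℕ.+-comm 1 _) (cong (ℕ._+ 1) (ℕ.*-comm (n ℕ./ 2) 2))))
... | suc (suc _) | s≤s (s≤s ())

i*j≡-1⇒unit : ∀ i j → i ℤ.* j ≡ -1ℤ → Unit± i
i*j≡-1⇒unit i j eq = unit i (ℕ.m*n≡1⇒m≡1 ∣ i ∣ ∣ j ∣ (trans (sym (ℤ.abs-* i j)) (cong ∣_∣ eq)))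
  where
  unit : ∀ i → ∣ i ∣ ≡ 1 → Unit± i
  unit (+ 1)    refl = inj₁ refl
  unit -[1+ 0 ] refl = inj₂ refl

halve : ∀ {x i} → x ℚ.+ x ≡ (+ 2 ℤ.* i) /1 → x ≡ i /1
halve {x} {i} eq = begin
  x                       ≡⟨ half-double x ⟩
  ½ ℚ.* (x ℚ.+ x)         ≡⟨ cong (½ ℚ.*_) (trans eq (/1-homo-* (+ 2) i)) ⟩
  ½ ℚ.* ((+ 2) /1 ℚ.* i /1) ≡⟨ ℚ.*-assoc ½ ((+ 2) /1) (i /1) ⟨
  1ℚ ℚ.* i /1             ≡⟨ ℚ.*-identityˡ (i /1) ⟩
  i /1                    ∎
  where
  open ≡-Reasoning
  half-double : ∀ x → x ≡ ½ ℚ.* (x ℚ.+ x)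
  half-double x = sym (trans (ℚ.*-distribˡ-+ ½ x x) (trans (sym (ℚ.*-distribʳ-+ x ½ ½)) (ℚ.*-identityˡ x)))

module TwoModFour (d l : ℕ) (d≡ : + d ≡ + 2 ℤ.* (+ 2 ℤ.* + l ℤ.+ 1ℤ)) (sf : Squarefree d) where

  open Field d
  open Integrality d
  open ≡-Reasoning

  m : ℤ
  m = + 2 ℤ.* + l ℤ.+ 1ℤ

  -- This excludes half-integral coordinates. As d is even, so is t²; then 4 divides dw², and since
  -- d/2 is odd, w² is even too.
  trace-norm⇒even : ∀ t u w → + d ℤ.* (w ℤ.* w) ≡ t ℤ.* t ℤ.- + 4 ℤ.* u →
    (∃ λ t′ → t ≡ + 2 ℤ.* t′) × (∃ λ w′ → w ≡ + 2 ℤ.* w′)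
  trace-norm⇒even t u w eq with even-square⇒even t (m ℤ.* (w ℤ.* w) ℤ.+ + 2 ℤ.* u)
    (trans (shift t u) (trans (cong (ℤ._+ + 4 ℤ.* u) (sym eq))
      (trans (cong (λ i → i ℤ.* (w ℤ.* w) ℤ.+ + 4 ℤ.* u) d≡) (collect m w u))))
    where
    shift : ∀ t u → t ℤ.* t ≡ t ℤ.* t ℤ.- + 4 ℤ.* u ℤ.+ + 4 ℤ.* u
    shift = ℤ-RingSolver.solve-∀
    collect : ∀ m w u → + 2 ℤ.* m ℤ.* (w ℤ.* w) ℤ.+ + 4 ℤ.* u ≡ + 2 ℤ.* (m ℤ.* (w ℤ.* w) ℤ.+ + 2 ℤ.* u)
    collect = ℤ-RingSolver.solve-∀
  ... | t′ , refl = (t′ , refl) , even-square⇒even w (t′ ℤ.* t′ ℤ.- u ℤ.- + l ℤ.* (w ℤ.* w))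
    (ℤ.*-cancelˡ-≡ (+ 2) _ _ (trans (isolate (+ l) w) (trans
      (cong (λ i → i ℤ.* (w ℤ.* w) ℤ.- + 4 ℤ.* + l ℤ.* (w ℤ.* w)) (sym d≡))
      (trans (cong (ℤ._- + 4 ℤ.* + l ℤ.* (w ℤ.* w)) eq) (collect t′ u (+ l) w)))))
    where
    isolate : ∀ l w → + 2 ℤ.* (w ℤ.* w) ≡ + 2 ℤ.* (+ 2 ℤ.* l ℤ.+ 1ℤ) ℤ.* (w ℤ.* w) ℤ.- + 4 ℤ.* l ℤ.* (w ℤ.* w)
    isolate = ℤ-RingSolver.solve-∀
    collect : ∀ t u l w → + 2 ℤ.* t ℤ.* (+ 2 ℤ.* t) ℤ.- + 4 ℤ.* u ℤ.- + 4 ℤ.* l ℤ.* (w ℤ.* w)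
      ≡ + 2 ℤ.* (+ 2 ℤ.* (t ℤ.* t ℤ.- u ℤ.- l ℤ.* (w ℤ.* w)))
    collect = ℤ-RingSolver.solve-∀

  -- The two norms give the trace t = 2x, and d (2y)² = t² - 4 N(α).
  N-integral⇒ℤ√ : ∀ {α} → Integral (N α) → Integral (N (α ⊕ 1#)) → α ∈ ℤ√
  N-integral⇒ℤ√ {x + y √} (u , Nα≡) (v , Nα+1≡) =
    let w , 2y≡ = squarefree⇒integral {d} {y ℚ.+ y} sf (t ℤ.* t ℤ.- + 4 ℤ.* u , d[2y]²≡)
        (t′ , t≡) , (w′ , w≡) = trace-norm⇒even t u w (dw²≡ w 2y≡)
    in t′ , w′ , cong₂ _+_√
         (halve {x} {t′} (trans 2x≡ (cong _/1 t≡))) (halve {y} {w′} (trans 2y≡ (cong _/1 w≡)))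
    where
    t = v ℤ.- u ℤ.- 1ℤ
    Nα = N (x + y √)

    2x≡ : x ℚ.+ x ≡ t /1
    2x≡ = begin
      x ℚ.+ x                              ≡⟨ polarize dℚ x y ⟩
      N ((x + y √) ⊕ 1#) ℚ.- Nα ℚ.- 1ℚ
        ≡⟨ cong₂ (λ a b → a ℚ.- b ℚ.- 1ℚ) Nα+1≡ Nα≡ ⟩
      v /1 ℚ.- u /1 ℚ.- 1ℚ                 ≡⟨ cong (λ a → v /1 ℚ.+ a ℚ.- 1ℚ) (/1-homo-neg u) ⟨
      v /1 ℚ.+ (ℤ.- u) /1 ℚ.- 1ℚ           ≡⟨ cong (ℚ._- 1ℚ) (/1-homo-+ v (ℤ.- u)) ⟨
      (v ℤ.- u) /1 ℚ.+ -1ℤ /1              ≡⟨ /1-homo-+ (v ℤ.- u) -1ℤ ⟨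
      t /1                                 ∎
      where
      polarize : ∀ D x y → x ℚ.+ x ≡
        (x ℚ.+ 1ℚ) ℚ.* (x ℚ.+ 1ℚ) ℚ.- D ℚ.* ((y ℚ.+ 0ℚ) ℚ.* (y ℚ.+ 0ℚ)) ℚ.- (x ℚ.* x ℚ.- D ℚ.* (y ℚ.* y)) ℚ.- 1ℚ
      polarize = solve-∀ ℚ-ring

    d[2y]²≡ : dℚ ℚ.* ((y ℚ.+ y) ℚ.* (y ℚ.+ y)) ≡ (t ℤ.* t ℤ.- + 4 ℤ.* u) /1
    d[2y]²≡ = begin
      dℚ ℚ.* ((y ℚ.+ y) ℚ.* (y ℚ.+ y))
        ≡⟨ discriminant dℚ x y ⟩
      (x ℚ.+ x) ℚ.* (x ℚ.+ x) ℚ.- (Nα ℚ.+ Nα ℚ.+ (Nα ℚ.+ Nα))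
        ≡⟨ cong₂ (λ a b → a ℚ.* a ℚ.- (b ℚ.+ b ℚ.+ (b ℚ.+ b))) 2x≡ Nα≡ ⟩
      t /1 ℚ.* t /1 ℚ.- (u /1 ℚ.+ u /1 ℚ.+ (u /1 ℚ.+ u /1))
        ≡⟨ cong (λ a → t /1 ℚ.* t /1 ℚ.- (a ℚ.+ a)) (/1-homo-+ u u) ⟨
      t /1 ℚ.* t /1 ℚ.- ((u ℤ.+ u) /1 ℚ.+ (u ℤ.+ u) /1)
        ≡⟨ cong (λ a → t /1 ℚ.* t /1 ℚ.- a) (/1-homo-+ (u ℤ.+ u) (u ℤ.+ u)) ⟨
      t /1 ℚ.* t /1 ℚ.- (u ℤ.+ u ℤ.+ (u ℤ.+ u)) /1
        ≡⟨ cong₂ ℚ._+_ (/1-homo-* t t) (/1-homo-neg (u ℤ.+ u ℤ.+ (u ℤ.+ u))) ⟨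
      (t ℤ.* t) /1 ℚ.+ (ℤ.- (u ℤ.+ u ℤ.+ (u ℤ.+ u))) /1
        ≡⟨ /1-homo-+ (t ℤ.* t) (ℤ.- (u ℤ.+ u ℤ.+ (u ℤ.+ u))) ⟨
      (t ℤ.* t ℤ.- (u ℤ.+ u ℤ.+ (u ℤ.+ u))) /1
        ≡⟨ cong _/1 (quadruple (t ℤ.* t) u) ⟩
      (t ℤ.* t ℤ.- + 4 ℤ.* u) /1 ∎
      where
      discriminant : ∀ D x y → D ℚ.* ((y ℚ.+ y) ℚ.* (y ℚ.+ y)) ≡
        (x ℚ.+ x) ℚ.* (x ℚ.+ x) ℚ.- ((x ℚ.* x ℚ.- D ℚ.* (y ℚ.* y)) ℚ.+ (x ℚ.* x ℚ.- D ℚ.* (y ℚ.* y))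
          ℚ.+ ((x ℚ.* x ℚ.- D ℚ.* (y ℚ.* y)) ℚ.+ (x ℚ.* x ℚ.- D ℚ.* (y ℚ.* y))))
      discriminant = solve-∀ ℚ-ring
      quadruple : ∀ s u → s ℤ.- (u ℤ.+ u ℤ.+ (u ℤ.+ u)) ≡ s ℤ.- + 4 ℤ.* u
      quadruple = ℤ-RingSolver.solve-∀

    dw²≡ : ∀ w → y ℚ.+ y ≡ w /1 → + d ℤ.* (w ℤ.* w) ≡ t ℤ.* t ℤ.- + 4 ℤ.* u
    dw²≡ w 2y≡ = /1-injective {+ d ℤ.* (w ℤ.* w)} {t ℤ.* t ℤ.- + 4 ℤ.* u} (begin
      (+ d ℤ.* (w ℤ.* w)) /1            ≡⟨ /1-homo-* (+ d) (w ℤ.* w) ⟩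
      dℚ ℚ.* (w ℤ.* w) /1               ≡⟨ cong (dℚ ℚ.*_) (/1-homo-* w w) ⟩
      dℚ ℚ.* (w /1 ℚ.* w /1)            ≡⟨ cong (λ a → dℚ ℚ.* (a ℚ.* a)) 2y≡ ⟨
      dℚ ℚ.* ((y ℚ.+ y) ℚ.* (y ℚ.+ y))  ≡⟨ d[2y]²≡ ⟩
      (t ℤ.* t ℤ.- + 4 ℤ.* u) /1        ∎)

  𝓞⊆ℤ√ : ∀ {α} → α ∈ 𝓞 d → α ∈ ℤ√
  𝓞⊆ℤ√ (n , c , root) = let Nα , Nα+1 = Root.root-N-integral c root in N-integral⇒ℤ√ Nα Nα+1

  square≡0⇒≡0 : ∀ {x} → x ℚ.* x ≡ 0ℚ → x ≡ 0ℚ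
  square≡0⇒≡0 {x} x²≡0 with x ℚ.≟ 0ℚ
  ... | yes x≡0 = x≡0
  ... | no x≢0 = begin
    x                    ≡⟨ ℚ.*-identityʳ x ⟨
    x ℚ.* 1ℚ             ≡⟨ cong (x ℚ.*_) (ℚ.*-inverseʳ x) ⟨
    x ℚ.* (x ℚ.* x⁻¹)    ≡⟨ ℚ.*-assoc x x x⁻¹ ⟨
    x ℚ.* x ℚ.* x⁻¹      ≡⟨ cong (ℚ._* x⁻¹) x²≡0 ⟩
    0ℚ ℚ.* x⁻¹           ≡⟨ ℚ.*-zeroˡ x⁻¹ ⟩
    0ℚ                   ∎
    where
    instance _ = ℚ.≢-nonZero x≢0
    x⁻¹ = ℚ.1/ x

  -- A rational root is an integer r, and r² = d divides the squarefree d, which forces ∣r∣ = 1 and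
  -- d = 1.
  dℚ≢square : d ≢ 1 → ∀ x → x ℚ.* x ≢ dℚ
  dℚ≢square d≢1 x x²≡d = d≢1 (trans d≡∣r∣² (cong (λ t → t ℕ.* t)
    (sf ∣ r ∣ (divides 1 (trans d≡∣r∣² (sym (ℕ.*-identityˡ _)))))))
    where
    integral = squarefree⇒integral {1} {x} (λ k k²∣1 → ℕ.m*n≡1⇒m≡1 k k (∣1⇒≡1 k²∣1))
      (+ d , trans (ℚ.*-identityˡ _) x²≡d)
    r = proj₁ integral
    x≡r = proj₂ integral
    d≡∣r∣² : d ≡ ∣ r ∣ ℕ.* ∣ r ∣
    d≡∣r∣² = trans (cong ∣_∣ (/1-injective {+ d} {r ℤ.* r}
      (trans (sym x²≡d) (trans (cong (λ t → t ℚ.* t) x≡r) (sym (/1-homo-* r r)))))) (ℤ.abs-* r r)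

  -- With y ≠ 0, norm zero would make x/y a rational square root of d. This is what allows division
  -- by the norm of a nonzero element.
  N≡0⇒≡0 : d ≢ 1 → ∀ {α} → N α ≡ 0ℚ → α ≡ 0#
  N≡0⇒≡0 d≢1 {x + y √} N≡0 with y ℚ.≟ 0ℚ
  ... | yes refl = cong (_+ 0ℚ √) (square≡0⇒≡0 (trans (sym (N-rational x)) N≡0))
  ... | no y≢0 = contradiction (begin
    x ℚ.* y⁻¹ ℚ.* (x ℚ.* y⁻¹)                                     ≡⟨ expand dℚ x y y⁻¹ ⟩
    N (x + y √) ℚ.* (y⁻¹ ℚ.* y⁻¹) ℚ.+ dℚ ℚ.* (y ℚ.* y⁻¹ ℚ.* (y ℚ.* y⁻¹))
      ≡⟨ cong₂ (λ a b → a ℚ.* (y⁻¹ ℚ.* y⁻¹) ℚ.+ dℚ ℚ.* (b ℚ.* b)) N≡0 (ℚ.*-inverseʳ y) ⟩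
    0ℚ ℚ.* (y⁻¹ ℚ.* y⁻¹) ℚ.+ dℚ ℚ.* (1ℚ ℚ.* 1ℚ)                   ≡⟨ collapse dℚ y⁻¹ ⟩
    dℚ                                                            ∎) (dℚ≢square d≢1 (x ℚ.* y⁻¹))
    where
    instance _ = ℚ.≢-nonZero y≢0
    y⁻¹ = ℚ.1/ y
    expand : ∀ D x y z → x ℚ.* z ℚ.* (x ℚ.* z) ≡
      (x ℚ.* x ℚ.- D ℚ.* (y ℚ.* y)) ℚ.* (z ℚ.* z) ℚ.+ D ℚ.* (y ℚ.* z ℚ.* (y ℚ.* z))
    expand = solve-∀ ℚ-ring
    collapse : ∀ D z → 0ℚ ℚ.* (z ℚ.* z) ℚ.+ D ℚ.* (1ℚ ℚ.* 1ℚ) ≡ D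
    collapse = solve-∀ ℚ-ring

-- The ideal class of (2, √d)

module ClassNumber (d l : ℕ) (d≡ : + d ≡ + 2 ℤ.* (+ 2 ℤ.* + l ℤ.+ 1ℤ)) (sf : Squarefree d) where

  open Field d
  open Integrality d
  open TwoModFour d l d≡ sf
  open ≡-Reasoning

  open CommutativeRing commutativeRing using (*-assoc; *-identityˡ; *-identityʳ; zeroˡ)
    renaming (+-identityˡ to ⊕-identityˡ; +-identityʳ to ⊕-identityʳ)

  1∈𝓞 : 1# ∈ 𝓞 d
  1∈𝓞 = 1 , (λ _ → -1ℤ) , cong₂ (λ α β → α ⊕ (β ⊕ 0#)) (*-identityʳ 1#) (*-identityʳ (fromℤ d -1ℤ))

  0∈𝓞 : 0# ∈ 𝓞 d
  0∈𝓞 = 1 , (λ _ → 0ℤ) , cong₂ (λ α β → α ⊕ (β ⊕ 0#)) (zeroˡ 1#) (zeroˡ 1#)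

  √d : ℚ[√ d ]
  √d = 0ℚ + 1ℚ √

  ⟨1⟩ ⟨2,√d⟩ : FractionalIdeal d
  ⟨1⟩    = record { size = 1 ; generators = 1# ∷ [] ; nonzero = 0F , λ () }
  ⟨2,√d⟩ = record { size = 2 ; generators = fromℤ d (+ 2) ∷ √d ∷ [] ; nonzero = 0F , λ () }

  1∈⟨1⟩ : 1# ∈ ⟦ d ⟧ ⟨1⟩
  1∈⟨1⟩ = 1# ∷ [] , (λ { 0F → 1∈𝓞 }) , sym (trans (⊕-identityʳ _) (*-identityˡ 1#))

  2∈⟨2,√d⟩ : fromℤ d (+ 2) ∈ ⟦ d ⟧ ⟨2,√d⟩
  2∈⟨2,√d⟩ = 1# ∷ 0# ∷ [] , (λ { 0F → 1∈𝓞 ; 1F → 0∈𝓞 }) ,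
    sym (trans (cong₂ (λ α β → α ⊕ (β ⊕ 0#)) (*-identityˡ (fromℤ d (+ 2))) (zeroˡ √d)) (⊕-identityʳ _))

  √d∈⟨2,√d⟩ : √d ∈ ⟦ d ⟧ ⟨2,√d⟩
  √d∈⟨2,√d⟩ = 0# ∷ 1# ∷ [] , (λ { 0F → 0∈𝓞 ; 1F → 1∈𝓞 }) ,
    sym (trans (cong₂ (λ α β → α ⊕ (β ⊕ 0#)) (zeroˡ (fromℤ d (+ 2))) (*-identityˡ √d))
      (trans (⊕-identityˡ _) (⊕-identityʳ √d)))

  ⟨1⟩⊆ℤ√ : ∀ {α} → α ∈ ⟦ d ⟧ ⟨1⟩ → α ∈ ℤ√
  ⟨1⟩⊆ℤ√ (c , c∈𝓞 , refl) = ⊕-closed (*-closed (𝓞⊆ℤ√ (c∈𝓞 0F)) (fromℤ∈ℤ√ 1ℤ)) 0∈ℤ√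

  -- N((2p + ds) + (2q + r)√d) is even because d is.
  N-⟨2,√d⟩ : ∀ {γ} → γ ∈ ⟦ d ⟧ ⟨2,√d⟩ →
    ∃₂ λ x y → ∃ λ g → γ ≡ (x /1) + (y /1) √ × norm (+ d) x y ≡ + 2 ℤ.* g
  N-⟨2,√d⟩ (c , c∈𝓞 , refl) = combination (𝓞⊆ℤ√ (c∈𝓞 0F)) (𝓞⊆ℤ√ (c∈𝓞 1F))
    where
    combination : ∀ {α β} → α ∈ ℤ√ → β ∈ ℤ√ → ∃₂ λ x y → ∃ λ g →
      (α * fromℤ d (+ 2)) ⊕ ((β * √d) ⊕ 0#) ≡ (x /1) + (y /1) √ × norm (+ d) x y ≡ + 2 ℤ.* g
    combination α∈@(p , q , _) β∈@(r , s , _) =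
      let _ , y , eq = ⊕-closed (*-closed α∈ (fromℤ∈ℤ√ (+ 2)))
            (⊕-closed (*-closed β∈ (0ℤ , 1ℤ , refl)) 0∈ℤ√) in
      x , y , + 2 ℤ.* (h ℤ.* h) ℤ.- m ℤ.* (y ℤ.* y) ,
      trans eq (cong (λ i → (i /1) + (y /1) √) (x≡ p q r s)) ,
      trans (norm-def (+ d) x y) (trans (cong (λ D → x ℤ.* x ℤ.- D ℤ.* (y ℤ.* y)) d≡) (halve-norm m h y))
      where
      h = p ℤ.+ m ℤ.* s
      x = + 2 ℤ.* h
      halve-norm : ∀ m h y → + 2 ℤ.* h ℤ.* (+ 2 ℤ.* h) ℤ.- + 2 ℤ.* m ℤ.* (y ℤ.* y)
        ≡ + 2 ℤ.* (+ 2 ℤ.* (h ℤ.* h) ℤ.- m ℤ.* (y ℤ.* y))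
      halve-norm = ℤ-RingSolver.solve-∀
      simplify : ∀ m p q r s →
        p ℤ.* + 2 ℤ.+ + 2 ℤ.* m ℤ.* (q ℤ.* 0ℤ) ℤ.+ (r ℤ.* 0ℤ ℤ.+ + 2 ℤ.* m ℤ.* (s ℤ.* 1ℤ) ℤ.+ 0ℤ)
        ≡ + 2 ℤ.* (p ℤ.+ m ℤ.* s)
      simplify = ℤ-RingSolver.solve-∀
      x≡ : ∀ p q r s →
        p ℤ.* + 2 ℤ.+ + d ℤ.* (q ℤ.* 0ℤ) ℤ.+ (r ℤ.* 0ℤ ℤ.+ + d ℤ.* (s ℤ.* 1ℤ) ℤ.+ 0ℤ)
        ≡ + 2 ℤ.* (p ℤ.+ m ℤ.* s)
      x≡ p q r s = trans
        (cong (λ D → p ℤ.* + 2 ℤ.+ D ℤ.* (q ℤ.* 0ℤ) ℤ.+ (r ℤ.* 0ℤ ℤ.+ D ℤ.* (s ℤ.* 1ℤ) ℤ.+ 0ℤ)) d≡)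
        (simplify m p q r s)

  -- The hypotheses amount to γ = α/β and δ = γw. Cancelling β after taking norms requires inverses
  -- only in ℚ. Used with δ = 2 and δ = √d, it shows that the norm of γ divides 4 and -d.
  N-cancel : d ≢ 1 → ∀ α β γ δ w → β ≢ 0# → α * 1# ≡ β * γ → β * δ ≡ α * w → N δ ≡ N γ ℚ.* N w
  N-cancel d≢1 α β γ δ w β≢0 α≡βγ βδ≡αw = begin
    N δ                                ≡⟨ insert (N δ) ⟩
    Nβ⁻¹ ℚ.* (N β ℚ.* N δ)             ≡⟨ cong (Nβ⁻¹ ℚ.*_) (N-* β δ) ⟨
    Nβ⁻¹ ℚ.* N (β * δ)                 ≡⟨ cong (λ t → Nβ⁻¹ ℚ.* N t) βδ≡αw ⟩
    Nβ⁻¹ ℚ.* N (α * w)                 ≡⟨ cong (λ t → Nβ⁻¹ ℚ.* N (t * w)) (trans (sym (*-identityʳ α)) α≡βγ) ⟩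
    Nβ⁻¹ ℚ.* N ((β * γ) * w)           ≡⟨ cong (λ t → Nβ⁻¹ ℚ.* N t) (*-assoc β γ w) ⟩
    Nβ⁻¹ ℚ.* N (β * (γ * w))           ≡⟨ cong (Nβ⁻¹ ℚ.*_) (N-* β (γ * w)) ⟩
    Nβ⁻¹ ℚ.* (N β ℚ.* N (γ * w))       ≡⟨ insert (N (γ * w)) ⟨
    N (γ * w)                          ≡⟨ N-* γ w ⟩
    N γ ℚ.* N w                        ∎
    where
    instance _ = ℚ.≢-nonZero (λ Nβ≡0 → β≢0 (N≡0⇒≡0 d≢1 {β} Nβ≡0))
    Nβ⁻¹ = ℚ.1/ N β
    insert : ∀ z → z ≡ Nβ⁻¹ ℚ.* (N β ℚ.* z)
    insert z = sym (trans (sym (ℚ.*-assoc Nβ⁻¹ (N β) z))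
      (trans (cong (ℚ._* z) (ℚ.*-inverseˡ (N β))) (ℚ.*-identityˡ z)))

  N-√d : N √d ≡ (ℤ.- + d) /1
  N-√d = trans (expand dℚ) (sym (/1-homo-neg (+ d)))
    where
    expand : ∀ D → 0ℚ ℚ.* 0ℚ ℚ.- D ℚ.* (1ℚ ℚ.* 1ℚ) ≡ ℚ.- D
    expand = solve-∀ ℚ-ring

  -- g divides 2 and the odd number d / 2.
  2g*nu≡4∧2g*nv≡-d⇒unit : ∀ g nu nv → + 2 ℤ.* g ℤ.* nu ≡ + 4 → + 2 ℤ.* g ℤ.* nv ≡ ℤ.- + d → Unit± g
  2g*nu≡4∧2g*nv≡-d⇒unit g nu nv eq₄ eq-d = i*j≡-1⇒unit g (nv ℤ.+ + l ℤ.* nu)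
   (ℤ.*-cancelˡ-≡ (+ 2) _ -1ℤ (begin
    + 2 ℤ.* (g ℤ.* (nv ℤ.+ + l ℤ.* nu))                        ≡⟨ expand g nu nv (+ l) ⟩
    + 2 ℤ.* g ℤ.* nv ℤ.+ + l ℤ.* (+ 2 ℤ.* g ℤ.* nu)
      ≡⟨ cong₂ (λ i j → i ℤ.+ + l ℤ.* j) (trans eq-d (cong ℤ.-_ d≡)) eq₄ ⟩
    ℤ.- (+ 2 ℤ.* (+ 2 ℤ.* + l ℤ.+ 1ℤ)) ℤ.+ + l ℤ.* + 4         ≡⟨ collapse (+ l) ⟩
    -[1+ 1 ]                                                   ∎))
    where
    expand : ∀ g nu nv l → + 2 ℤ.* (g ℤ.* (nv ℤ.+ l ℤ.* nu)) ≡ + 2 ℤ.* g ℤ.* nv ℤ.+ l ℤ.* (+ 2 ℤ.* g ℤ.* nu)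
    expand = ℤ-RingSolver.solve-∀
    collapse : ∀ l → ℤ.- (+ 2 ℤ.* (+ 2 ℤ.* l ℤ.+ 1ℤ)) ℤ.+ l ℤ.* + 4 ≡ -[1+ 1 ]
    collapse = ℤ-RingSolver.solve-∀

  -- From I = α⟨1⟩ = β⟨2,√d⟩ the quotient γ = α/β generates ⟨2,√d⟩. Membership in that ideal makes
  -- its norm an even number 2g, and dividing both 2 and √d makes g a unit.
  ∼⇒norm≡±2 : d ≢ 1 → ∀ {I} → (d ∼ I) ⟨1⟩ → (d ∼ I) ⟨2,√d⟩ →
    ∃₂ λ x y → ∃ λ e → Unit± e × norm (+ d) x y ≡ + 2 ℤ.* e
  ∼⇒norm≡±2 d≢1 (α , _ , I⊆α⟨1⟩ , α⟨1⟩⊆I) (β , β≢0 , I⊆β⟨2,√d⟩ , β⟨2,√d⟩⊆I) =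
    let γ , γ∈ , α≡βγ = I⊆β⟨2,√d⟩ (α⟨1⟩⊆I (1# , 1∈⟨1⟩ , refl))
        u , u∈ , 2β≡αu = I⊆α⟨1⟩ (β⟨2,√d⟩⊆I (fromℤ d (+ 2) , 2∈⟨2,√d⟩ , refl))
        v , v∈ , √dβ≡αv = I⊆α⟨1⟩ (β⟨2,√d⟩⊆I (√d , √d∈⟨2,√d⟩ , refl))
        x , y , g , γ≡ , norm≡2g = N-⟨2,√d⟩ γ∈
        nu , Nu≡ = N-integral (⟨1⟩⊆ℤ√ u∈)
        nv , Nv≡ = N-integral (⟨1⟩⊆ℤ√ v∈)
        Nγ≡ = trans (cong N γ≡) (trans (N-ℤ√ x y) (cong _/1 norm≡2g))
        2g*nu≡4 = /1-injective {+ 2 ℤ.* g ℤ.* nu} {+ 4} (trans (/1-homo-* (+ 2 ℤ.* g) nu)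
          (trans (sym (cong₂ ℚ._*_ Nγ≡ Nu≡))
          (trans (sym (N-cancel d≢1 α β γ (fromℤ d (+ 2)) u β≢0 α≡βγ 2β≡αu)) (N-rational ((+ 2) /1)))))
        2g*nv≡-d = /1-injective {+ 2 ℤ.* g ℤ.* nv} {ℤ.- + d} (trans (/1-homo-* (+ 2 ℤ.* g) nv)
          (trans (sym (cong₂ ℚ._*_ Nγ≡ Nv≡))
          (trans (sym (N-cancel d≢1 α β γ √d v β≢0 α≡βγ √dβ≡αv)) N-√d)))
    in x , y , g , 2g*nu≡4∧2g*nv≡-d⇒unit g nu nv 2g*nu≡4 2g*nv≡-d , norm≡2g

  norm≢±2⇒1<h : d ≢ 1 → (∀ {x y e} → Unit± e → norm (+ d) x y ≢ + 2 ℤ.* e) →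
    ∀ h → IsClassNumber d h → 1 ℕ.< h
  norm≢±2⇒1<h d≢1 norm≢±2 h (f , _ , surjective) = 1<h h f (surjective ⟨1⟩) (surjective ⟨2,√d⟩)
    where
    1<h : ∀ h (f : Fin h → FractionalIdeal d) →
      (∃ λ i → ∀ {j} → j ≡ i → (d ∼ f j) ⟨1⟩) →
      (∃ λ i → ∀ {j} → j ≡ i → (d ∼ f j) ⟨2,√d⟩) → 1 ℕ.< h
    -- Surjectivity supplies an index for each ideal, which excludes h = 0; for h = 1 both indices
    -- are `0F`, so the two ideals are equivalent to the same `f 0F`.
    1<h 1 f (0F , f0∼⟨1⟩) (0F , f0∼⟨2,√d⟩) =
      let _ , _ , _ , ±e , norm≡ = ∼⇒norm≡±2 d≢1 {f 0F} (f0∼⟨1⟩ refl) (f0∼⟨2,√d⟩ refl)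
      in contradiction norm≡ (norm≢±2 ±e)
    1<h (suc (suc _)) _ _ _ = s≤s (s≤s z≤n)

-- The unit and the parity of D(b, s, k)

4bs+1-cast : ∀ b s → + (4 ℕ.* b ℕ.* s ℕ.+ 1) ≡ + 4 ℤ.* + b ℤ.* + s ℤ.+ 1ℤ
4bs+1-cast b s = cong (ℤ._+ 1ℤ) (trans (ℤ.pos-* (4 ℕ.* b) s) (cong (ℤ._* + s) (ℤ.pos-* 4 b)))

D-cast : ∀ b s k → + D b s k ≡ Unit.Δ (+ b) (+ s) k
D-cast b s k = cong₂ ℤ._+_ a≡ (trans (cong (λ t → + (n ℕ.* t)) (ℕ.*-identityʳ n))
  (trans (ℤ.pos-* n n) (cong (λ t → t ℤ.* t) n≡)))
  where
  a = (4 ℕ.* b ℕ.* s ℕ.+ 1) ℕ.^ k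
  n = b ℕ.* a ℕ.+ s
  pos-^ : ∀ m j → + (m ℕ.^ j) ≡ (+ m) ℤ.^ j
  pos-^ m zero    = refl
  pos-^ m (suc j) = trans (ℤ.pos-* m (m ℕ.^ j)) (cong (ℤ._*_ (+ m)) (pos-^ m j))
  a≡ : + a ≡ (+ 4 ℤ.* + b ℤ.* + s ℤ.+ 1ℤ) ℤ.^ k
  a≡ = trans (pos-^ (4 ℕ.* b ℕ.* s ℕ.+ 1) k) (cong (ℤ._^ k) (4bs+1-cast b s))
  n≡ : + n ≡ + b ℤ.* (+ 4 ℤ.* + b ℤ.* + s ℤ.+ 1ℤ) ℤ.^ k ℤ.+ + s
  n≡ = cong (ℤ._+ + s) (trans (ℤ.pos-* b a) (cong (ℤ._*_ (+ b)) a≡))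

∃-norm-D≡-1 : ∀ b s k → ∃₂ λ p q → norm (+ D b s k) p q ≡ -1ℤ
∃-norm-D≡-1 b s k =
  let p , q , norm≡-1 = Unit.∃-norm≡-1 (+ b) (+ s) k a≢0 in
  p , q , trans (cong (λ t → norm t p q) (D-cast b s k)) norm≡-1
  where
  a≢0 : (+ 4 ℤ.* + b ℤ.* + s ℤ.+ 1ℤ) ℤ.^ k ≢ 0ℤ
  a≢0 a≡0 with trans (sym (ℕ.+-comm (4 ℕ.* b ℕ.* s) 1))
    (ℤ.+-injective (trans (4bs+1-cast b s) (ℤ.i^n≡0⇒i≡0 (+ 4 ℤ.* + b ℤ.* + s ℤ.+ 1ℤ) k a≡0)))
  ... | ()

[4m+1]^k : ∀ m k → ∃ λ t → (4 ℕ.* m ℕ.+ 1) ℕ.^ k ≡ 4 ℕ.* t ℕ.+ 1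
[4m+1]^k m zero    = 0 , refl
[4m+1]^k m (suc k) = let t , eq = [4m+1]^k m k in
  4 ℕ.* m ℕ.* t ℕ.+ m ℕ.+ t , trans (cong ((4 ℕ.* m ℕ.+ 1) ℕ.*_) eq) (expand m t)
  where
  expand : ∀ m t → (4 ℕ.* m ℕ.+ 1) ℕ.* (4 ℕ.* t ℕ.+ 1) ≡ 4 ℕ.* (4 ℕ.* m ℕ.* t ℕ.+ m ℕ.+ t) ℕ.+ 1
  expand = ℕ-RingSolver.solve-∀

-- Modulo 4, a ≡ 1 as a power of 4bs + 1, hence n ≡ b + s modulo 2 is odd and n² ≡ 1 modulo 4.
-- Outside the excluded pair the odd number n is not 1, so n ≥ 3 and D ≥ 1 + 9.
D≡4l+2 : ∀ b s k → 0 ℕ.< s → Odd (b ℕ.+ s) → ¬ (b ≡ 0 × s ≡ 1) →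
  ∃ λ l → D b s k ≡ 2 ℕ.* (2 ℕ.* l ℕ.+ 1) × 10 ℕ.≤ D b s k
D≡4l+2 b s k 0<s odd b,s≢0,1 with [4m+1]^k (b ℕ.* s) k | odd⇒2r+1 odd
... | t , a≡ | r , b+s≡ = l , D≡ , 10≤D
  where
  a = (4 ℕ.* b ℕ.* s ℕ.+ 1) ℕ.^ k
  n = b ℕ.* a ℕ.+ s
  ρ = 2 ℕ.* b ℕ.* t ℕ.+ r
  l = t ℕ.+ ρ ℕ.* ρ ℕ.+ ρ

  a≡4t+1 : a ≡ 4 ℕ.* t ℕ.+ 1
  a≡4t+1 = trans (cong (λ i → (i ℕ.+ 1) ℕ.^ k) (ℕ.*-assoc 4 b s)) a≡

  n≡2ρ+1 : n ≡ 2 ℕ.* ρ ℕ.+ 1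
  n≡2ρ+1 = trans (cong (λ i → b ℕ.* i ℕ.+ s) a≡4t+1) (trans (shift b t s)
    (trans (cong (4 ℕ.* b ℕ.* t ℕ.+_) b+s≡) (collect b t r)))
    where
    shift : ∀ b t s → b ℕ.* (4 ℕ.* t ℕ.+ 1) ℕ.+ s ≡ 4 ℕ.* b ℕ.* t ℕ.+ (b ℕ.+ s)
    shift = ℕ-RingSolver.solve-∀
    collect : ∀ b t r → 4 ℕ.* b ℕ.* t ℕ.+ (2 ℕ.* r ℕ.+ 1) ≡ 2 ℕ.* (2 ℕ.* b ℕ.* t ℕ.+ r) ℕ.+ 1
    collect = ℕ-RingSolver.solve-∀

  D≡ : D b s k ≡ 2 ℕ.* (2 ℕ.* l ℕ.+ 1)
  D≡ = trans (cong₂ (λ i j → i ℕ.+ j ℕ.* (j ℕ.* 1)) a≡4t+1 n≡2ρ+1) (expand t ρ)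
    where
    expand : ∀ t ρ → 4 ℕ.* t ℕ.+ 1 ℕ.+ (2 ℕ.* ρ ℕ.+ 1) ℕ.* ((2 ℕ.* ρ ℕ.+ 1) ℕ.* 1)
      ≡ 2 ℕ.* (2 ℕ.* (t ℕ.+ ρ ℕ.* ρ ℕ.+ ρ) ℕ.+ 1)
    expand = ℕ-RingSolver.solve-∀

  n≢1 : ∀ b → ¬ (b ≡ 0 × s ≡ 1) → b ℕ.* a ℕ.+ s ≢ 1
  n≢1 zero    b,s≢0,1 s≡1 = b,s≢0,1 (refl , s≡1)
  n≢1 (suc b) _ n≡1 = ℕ.<⇒≢ (ℕ.+-mono-≤ (ℕ.≤-trans 1≤a (ℕ.m≤m+n a (b ℕ.* a))) 0<s) (sym n≡1)
    where
    1≤a : 1 ℕ.≤ a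
    1≤a = subst (1 ℕ.≤_) (sym a≡4t+1) (ℕ.m≤n+m 1 (4 ℕ.* t))

  1≤ρ : 1 ℕ.≤ ρ
  1≤ρ = ℕ.n≢0⇒n>0 λ ρ≡0 → n≢1 b b,s≢0,1 (trans n≡2ρ+1 (cong (λ i → 2 ℕ.* i ℕ.+ 1) ρ≡0))

  10≤D : 10 ℕ.≤ D b s k
  10≤D = subst (10 ℕ.≤_) (sym D≡) (ℕ.*-monoʳ-≤ 2 (ℕ.+-monoˡ-≤ 1 (ℕ.*-monoʳ-≤ 2
    (ℕ.+-mono-≤ (ℕ.≤-trans (ℕ.*-mono-≤ 1≤ρ 1≤ρ) (ℕ.m≤n+m (ρ ℕ.* ρ) t)) 1≤ρ))))

open import Data.Nat.Base using (_+_; _*_; _<_)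

theorem1p1 : (b s k : ℕ) → 0 < s → 0 < k →
    Odd (b + s) →
    Squarefree (D b s k) →
    41 * 61 * 175 * 1861 ∣ b →
    ¬ (b ≡ 0 × s ≡ 1) →
    (h : ℕ) → IsClassNumber (D b s k) h → 1 < h
theorem1p1 b s k 0<s _ odd sf _ b,s≢0,1 =
  let l , D≡ , 10≤D = D≡4l+2 b s k 0<s odd b,s≢0,1
      p , q , norm≡-1 = ∃-norm-D≡-1 b s k
      d≡ = trans (cong +_ D≡) (trans (ℤ.pos-* 2 (2 ℕ.* l ℕ.+ 1))
        (cong (λ i → + 2 ℤ.* (i ℤ.+ 1ℤ)) (ℤ.pos-* 2 l)))
  in ClassNumber.norm≢±2⇒1<h (D b s k) l d≡ sf
    (λ D≡1 → ℕ.<⇒≱ (s≤s (s≤s z≤n)) (subst (10 ℕ.≤_) D≡1 10≤D))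
    λ {x} {y} ±e norm≡2e →
      -- The descent works with natural coordinates; taking absolute values does not change the
      -- norms.
      Descent.norm≡-1⇒norm≢±2 (D b s k) 10≤D {∣ p ∣} {∣ q ∣} {∣ x ∣} {∣ y ∣} ±e
      (trans (norm-∣∣ (+ D b s k) p q) norm≡-1) (trans (norm-∣∣ (+ D b s k) x y) norm≡2e)
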